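{- As $n\to\infty$, \[\mathrm{sat}_\circlearrowright(n,F)=\Theta(n)\ \text{ for } F\in\{M_2,S_1,S_2\},\qquad \mathrm{sat}_\circlearrowright(n,F)=\Theta(n^2)\ \text{ for } F\in\{M_1,M_3,D_1,D_2\},\] and \[\mathrm{sat}_\circlearrowright(n,S_3)=\Omega(n),\qquad \mathrm{sat}_\circlearrowright(n,S_3)=O(n\log_2 n).\]
   Context: $\Omega_n=\{v_0,\dots,v_{n-1}\}$ carries the cyclic order $v_0<v_1<\dots<v_{n-1}<v_0$. A $3$-uniform convex geometric hypergraph ($3$-cgh) on $\Omega_n$ is a set $H\subseteq\binom{\Omega_n}{3}$. For a cgh $F$ on a cyclically ordered set $U$, $H$ contains a copy of $F$ if there is an injection $U\to\Omega_n$ preserving the cyclic order and mapping every edge of $F$ onto an edge of $H$; $H$ is $F$-free if it has no copy of $F$, and $F$-saturated if it is $F$-free and $H\cup\{e\}$ contains a copy of $F$ for every $e\in\binom{\Omega_n}{3}\setminus H$. $\mathrm{sat}_\circlearrowright(n,F)$ is the minimum number of edges of an $F$-saturated $3$-cgh on $\Omega_n$. The eight two-edge $3$-cghs are, on cyclically ordered points $u_0<u_1<\dots<u_k<u_0$: $M_1=\{\{u_0,u_1,u_2\},\{u_3,u_4,u_5\}\}$, $M_2=\{\{u_0,u_1,u_3\},\{u_2,u_4,u_5\}\}$, $M_3=\{\{u_0,u_2,u_4\},\{u_1,u_3,u_5\}\}$, $S_1=\{\{u_0,u_1,u_4\},\{u_0,u_2,u_3\}\}$, $S_2=\{\{u_0,u_1,u_2\},\{u_0,u_3,u_4\}\}$,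 $S_3=\{\{u_0,u_1,u_3\},\{u_0,u_2,u_4\}\}$, $D_1=\{\{u_0,u_1,u_2\},\{u_0,u_2,u_3\}\}$, $D_2=\{\{u_0,u_1,u_2\},\{u_0,u_1,u_3\}\}$. -}

module Defs where

open import Data.Nat as ℕ using (ℕ; zero; suc; _+_; _*_; _≤_)
open import Data.Nat.Logarithm using (⌊log₂_⌋)
open import Data.Fin as Fin using (Fin; zero; suc; _<_; _≟_; _<?_)
open import Data.Bool using (Bool; true; false; _∧_; _∨_; if_then_else_)
open import Data.List using (List; []; _∷_; map; allFin)
open import Data.Nat.ListAction using (sum)
open import Data.List.Relation.Unary.All using (All)
open import Data.Product using (Σ; ∃-syntax; _×_; _,_)
open import Data.Sum using (_⊎_)
open import Relation.Nullary using (¬_)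
open import Relation.Nullary.Decidable using (⌊_⌋)
open import Relation.Binary.PropositionalEquality using (_≡_)
open import Function.Definitions using (Injective)

-- Ω_n = Fin n, with cyclic order 0 < 1 < ... < n-1 < 0.

Inc : ∀ {n} → Fin n → Fin n → Fin n → Set
Inc x y z = x < y × y < z

Cyc : ∀ {n} → Fin n → Fin n → Fin n → Set
Cyc x y z = Inc x y z ⊎ Inc y z x ⊎ Inc z x y

-- A 3-uniform cgh on Ω_n: the edge {a,b,c} with a < b < c is present iff H a b c ≡ true.
-- (Values of H on non-increasing triples are ignored.)
Hyp : ℕ → Set
Hyp n = Fin n → Fin n → Fin n → Bool

HasEdge : ∀ {n} → Hyp n → Fin n → Fin n → Fin n → Set
HasEdge H x y z =
    (Inc x y z × H x y z ≡ true) ⊎ (Inc x z y × H x z y ≡ true)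
  ⊎ (Inc y x z × H y x z ≡ true) ⊎ (Inc y z x × H y z x ≡ true)
  ⊎ (Inc z x y × H z x y ≡ true) ⊎ (Inc z y x × H z y x ≡ true)

size : ∀ {n} → Hyp n → ℕ
size {n} H = sum (map (λ a → sum (map (λ b → sum (map (λ c →
  if ⌊ a <? b ⌋ ∧ ⌊ b <? c ⌋ ∧ H a b c then 1 else 0)
  (allFin n))) (allFin n))) (allFin n))

-- H ∪ {{x,y,z}}  (used with x < y < z)
addEdge : ∀ {n} → Hyp n → Fin n → Fin n → Fin n → Hyp n
addEdge H x y z a b c = H a b c ∨ (⌊ a ≟ x ⌋ ∧ ⌊ b ≟ y ⌋ ∧ ⌊ c ≟ z ⌋)

-- A (pattern) cgh F on the cyclically ordered set U = {u_0 < ... < u_{k-1}} = Fin k,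
-- given by its list of edges (each a triple of vertices).
record CGH : Set where
  constructor cgh
  field
    k     : ℕ
    edges : List (Fin k × Fin k × Fin k)
open CGH public

Contains : ∀ {n} → Hyp n → CGH → Set
Contains {n} H F =
  Σ (Fin (k F) → Fin n) λ φ →
    Injective _≡_ _≡_ φ
  × (∀ i j l → i < j → j < l → Cyc (φ i) (φ j) (φ l))
  × All (λ { (a , b , c) → HasEdge H (φ a) (φ b) (φ c) }) (edges F)

Free : ∀ {n} → Hyp n → CGH → Set
Free H F = ¬ Contains H F

Saturated : ∀ {n} → Hyp n → CGH → Set
Saturated {n} H F =
  Free H F ×
  (∀ (x y z : Fin n) → Inc x y z → H x y z ≡ false → Contains (addEdge H x y z) F)

SatUpper : CGH → (ℕ → ℕ) → Set
SatUpper F g = ∃[ C ] ∃[ N ] ∀ n → N ≤ n →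
  ∃[ H ] (Saturated {n} H F × size H ≤ C * g n)

-- sat(n,F) = Ω(g n): for large n every F-saturated H has |H| ≥ g(n)/(c+1)
SatLower : CGH → (ℕ → ℕ) → Set
SatLower F g = ∃[ c ] ∃[ N ] ∀ n → N ≤ n →
  ∀ (H : Hyp n) → Saturated H F → g n ≤ suc c * size H

SatTheta : CGH → (ℕ → ℕ) → Set
SatTheta F g = SatLower F g × SatUpper F g

lin quad nlog : ℕ → ℕ
lin n = n
quad n = n * n
nlog n = n * ⌊log₂ n ⌋

u0 : ∀ {m} → Fin (1 ℕ.+ m)
u1 : ∀ {m} → Fin (2 ℕ.+ m)
u2 : ∀ {m} → Fin (3 ℕ.+ m)
u3 : ∀ {m} → Fin (4 ℕ.+ m)
u4 : ∀ {m} → Fin (5 ℕ.+ m)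
u5 : ∀ {m} → Fin (6 ℕ.+ m)
u0 = Fin.zero
u1 = suc zero
u2 = suc (suc zero)
u3 = suc (suc (suc zero))
u4 = suc (suc (suc (suc zero)))
u5 = suc (suc (suc (suc (suc zero))))

M₁ M₂ M₃ S₁ S₂ S₃ D₁ D₂ : CGH
M₁ = cgh 6 ((u0 , u1 , u2) ∷ (u3 , u4 , u5) ∷ [])
M₂ = cgh 6 ((u0 , u1 , u3) ∷ (u2 , u4 , u5) ∷ [])
M₃ = cgh 6 ((u0 , u2 , u4) ∷ (u1 , u3 , u5) ∷ [])
S₁ = cgh 5 ((u0 , u1 , u4) ∷ (u0 , u2 , u3) ∷ [])
S₂ = cgh 5 ((u0 , u1 , u2) ∷ (u0 , u3 , u4) ∷ [])
S₃ = cgh 5 ((u0 , u1 , u3) ∷ (u0 , u2 , u4) ∷ [])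
D₁ = cgh 4 ((u0 , u1 , u2) ∷ (u0 , u2 , u3) ∷ [])
D₂ = cgh 4 ((u0 , u1 , u2) ∷ (u0 , u1 , u3) ∷ [])

{-# OPTIONS --safe #-}

-- Upper bounds.  Every F-free hypergraph extends greedily to an F-saturated one, and no triple added on
-- the way conflicts with an initial one.  It therefore suffices to find a free hypergraph that conflicts
-- with all but few triples:
--   the triples through 0 for M₁ and M₃, and the triples {a, a+1, c} with a even for D₁;
--   the triples {a, a+1, a+3} for M₂, {a, a+1, a+2} for S₁, and the latter with a ≡ 0, 1 mod 4 for S₂;
--   for S₃ the triples {p, b, q} with p < b < q, where [p, q] runs through a balanced binary tree of
--   nested intervals with distinct endpoints; each level of the tree leaves O(n) triples unblocked.
-- A D₂-free hypergraph always has at most n² edges.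
--
-- Lower bounds.  In a saturated hypergraph every triple is an edge or conflicts with one.  For S₁, S₂ and
-- S₃ it then meets an edge, so at most two vertices are isolated; for D₁ and D₂ it shares a pair with an
-- edge, so the graph of covered pairs has no independent triple.  Triples that cannot lie in any copy are
-- edges: the runs {a, a+1, a+2} for M₂, and all {a, a+1, b} for M₃.  For M₁ every x has a partner y such
-- that all triples {x, y, z} are edges.

module Submission where

open import Defs
open import Data.Bool as Bool using (Bool; true; false; not; _∧_; _∨_; if_then_else_; T)
open import Data.Bool.Properties using (∨-zeroʳ; not-injective; T?; T-≡)
open import Data.Empty using (⊥; ⊥-elim)
open import Data.Fin as Fin using (Fin; zero; suc; toℕ; fromℕ; fromℕ<; inject₁; _≟_; _<?_)
open import Data.Fin.Induction using (spo-wellFounded)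
open import Data.Fin.Properties as Finₚ
  using (toℕ-injective; toℕ<n; toℕ-fromℕ; toℕ-fromℕ<; toℕ-inject₁; any?; all?; injective⇒≤)
open import Data.Fin.Relation.Unary.Top using (view; ‵fromℕ; ‵inject₁; view-fromℕ; view-inject₁)
open import Data.List as List
  using (List; []; _∷_; _++_; map; filter; length; upTo; allFin; cartesianProduct; cartesianProductWith)
open import Data.List.Membership.Propositional using (_∈_; find)
open import Data.List.Membership.Propositional.Properties
  using (∈-allFin; ∈-upTo⁺; ∈-cartesianProduct⁺; ∈-cartesianProductWith⁺; ∈-filter⁺; ∈-filter⁻; ∈-lookup;
         ∈-++⁺ˡ; ∈-++⁺ʳ; ∈-map⁺)
open import Data.List.Properties using (length-++; length-map; length-upTo; length-tabulate; filter-++; map-cong)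
open import Data.List.Relation.Unary.All as All using (All; []; _∷_)
open import Data.List.Relation.Unary.AllPairs using ([]; _∷_)
open import Data.List.Relation.Unary.Any as Any using (Any; here; there; index)
open import Data.List.Relation.Unary.Any.Properties using (lookup-index)
open import Data.List.Relation.Unary.Unique.Propositional using (Unique)
import Data.List.Relation.Unary.Unique.Propositional.Properties as Unique
open import Data.Nat as ℕ using (ℕ; suc; _+_; _*_; _∸_; _<ᵇ_; _≤_; _<_; z≤n; s≤s; z<s)
open import Data.Nat.Induction using (<-rec)
open import Data.Nat.ListAction using (sum)
open import Data.Nat.Logarithm using (⌊log₂_⌋; ⌊log₂⌋-mono-≤; ⌊log₂⌊n/2⌋⌋≡⌊log₂n⌋∸1)
open import Data.Nat.Properties as ℕₚ using (<-trans; <-asym; <-irrefl; ≤-refl; ≤-trans; m≤n⇒m<n∨m≡n)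
open import Data.Nat.Solver using (module +-*-Solver)
open import Data.Product using (Σ; ∃; _×_; _,_; proj₁; proj₂)
open import Data.Sum as Sum using (_⊎_; inj₁; inj₂)
open import Data.Vec using (Vec; []; _∷_; lookup)
import Data.Vec.Functional as Vector
open import Data.Vec.Relation.Unary.Linked using (Linked; [-]; _∷_)
import Data.Vec.Relation.Unary.Linked.Properties as Linked
open import Function using (_∘_)
open import Function.Bundles using (Equivalence)
open import Function.Definitions using (Injective)
open import Induction.WellFounded using (Acc; acc)
open import Level using (0ℓ)
open import Relation.Binary using (tri<; tri≈; tri>)
open import Relation.Binary.PropositionalEquality
open import Relation.Binary.Structures using (IsStrictPartialOrder)
open import Relation.Nullary using (¬_; Dec; yes; no; does; contradiction)
open import Relation.Nullary.Decidable
  using (⌊_⌋; True; toWitness; map′; _×-dec_; _⊎-dec_; _→-dec_; ¬?; decidable-stable)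
open import Relation.Unary using (Pred; Decidable)

-- Edges are stored as increasing triples, but a copy only respects the cyclic order and may run
-- past vertex 0. The pattern is therefore cut at the index sent to the smallest vertex: a copy
-- becomes an ascending sequence of naturals, and a two-edge pattern on k points becomes k linear
-- patterns, one for each `r` in `turn r`. Freeness of a construction is then a check of k cases,
-- and a conflict is exhibited by one `r` and one ascending list of vertices.
--
-- The greedy extension of a construction is not explicit; it is known only to contain the
-- construction and no copy. Apart from `D₂`, the upper bounds therefore list every triple that
-- could still be present, in families with one or two free parameters. Many of these families sit
-- near 0 or n - 1, where a conflicting triple no longer fits.
--
-- For `S₃` a single split of an interval deals only with the triples that touch its ends or
-- straddle its two parts. Triples inside one part must be treated again, and the logarithmic depth
-- of this recursion is the origin of the factor log n.

Triple : ℕ → Set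
Triple n = Fin n × Fin n × Fin n

private variable
  m n : ℕ
  A B C : Set

-- Cyclic orders and copies of a two-edge pattern

cyc-rotate : {x y z : Fin n} → Cyc x y z → Cyc y z x
cyc-rotate (inj₁ p)        = inj₂ (inj₂ p)
cyc-rotate (inj₂ (inj₁ p)) = inj₁ p
cyc-rotate (inj₂ (inj₂ p)) = inj₂ (inj₁ p)

inc? : (x y z : Fin n) → Dec (Inc x y z)
inc? x y z = (x <? y) ×-dec (y <? z)

cyc? : (x y z : Fin n) → Dec (Cyc x y z)
cyc? x y z = inc? x y z ⊎-dec inc? y z x ⊎-dec inc? z x y

cyc-irrefl : {x y : Fin n} → ¬ Cyc x y y
cyc-irrefl (inj₁ (_ , p))        = <-irrefl refl p
cyc-irrefl (inj₂ (inj₁ (p , _))) = <-irrefl refl p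
cyc-irrefl (inj₂ (inj₂ (p , q))) = <-asym p q

-- With `x` fixed, `Cyc x` is the strict linear order of the other vertices read clockwise from `x`.
-- This lemma, transitivity and totality allow linear arguments from any base point, not only from
-- 0.
cyc-transʳ : {x a b c : Fin n} → Cyc x a b → Cyc x b c → Cyc a b c
cyc-transʳ (inj₁ (_ , p))        (inj₁ (_ , q))        = inj₁ (p , q)
cyc-transʳ (inj₁ (p , q))        (inj₂ (inj₁ (r , s))) = ⊥-elim (<-asym (<-trans p q) (<-trans r s))
cyc-transʳ (inj₁ (p , q))        (inj₂ (inj₂ (r , _))) = inj₂ (inj₂ (<-trans r p , q))
cyc-transʳ (inj₂ (inj₁ (_ , q))) (inj₁ (r , _))        = ⊥-elim (<-asym q r)
cyc-transʳ (inj₂ (inj₁ (p , _))) (inj₂ (inj₁ (r , _))) = inj₁ (p , r)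
cyc-transʳ (inj₂ (inj₁ (_ , q))) (inj₂ (inj₂ (_ , s))) = ⊥-elim (<-asym q s)
cyc-transʳ (inj₂ (inj₂ (p , _))) (inj₁ (r , _))        = ⊥-elim (<-asym p r)
cyc-transʳ (inj₂ (inj₂ (_ , q))) (inj₂ (inj₁ (r , s))) = inj₂ (inj₁ (r , <-trans s q))
cyc-transʳ (inj₂ (inj₂ (p , _))) (inj₂ (inj₂ (_ , s))) = ⊥-elim (<-asym p s)

cyc-trans : {x a b c : Fin n} → Cyc x a b → Cyc x b c → Cyc x a c
cyc-trans (inj₁ (p , q))        (inj₁ (_ , r))        = inj₁ (p , <-trans q r)
cyc-trans (inj₁ (p , q))        (inj₂ (inj₁ (r , s))) = ⊥-elim (<-asym (<-trans p q) (<-trans r s))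
cyc-trans (inj₁ (p , _))        (inj₂ (inj₂ (r , _))) = inj₂ (inj₂ (r , p))
cyc-trans (inj₂ (inj₁ (_ , q))) (inj₁ (r , _))        = ⊥-elim (<-asym q r)
cyc-trans (inj₂ (inj₁ (p , _))) (inj₂ (inj₁ (r , s))) = inj₂ (inj₁ (<-trans p r , s))
cyc-trans (inj₂ (inj₁ (_ , q))) (inj₂ (inj₂ (_ , s))) = ⊥-elim (<-asym q s)
cyc-trans (inj₂ (inj₂ (p , _))) (inj₁ (r , _))        = ⊥-elim (<-asym p r)
cyc-trans (inj₂ (inj₂ (_ , q))) (inj₂ (inj₁ (_ , s))) = inj₂ (inj₂ (s , q))
cyc-trans (inj₂ (inj₂ (p , _))) (inj₂ (inj₂ (_ , s))) = ⊥-elim (<-asym p s)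

cyc-total : {x a b : Fin n} → a ≢ x → b ≢ x → a ≢ b → Cyc x a b ⊎ Cyc x b a
cyc-total {x = x} {a} {b} a≢x b≢x a≢b with Finₚ.<-cmp x a | Finₚ.<-cmp x b | Finₚ.<-cmp a b
... | tri≈ _ e _ | _ | _ = ⊥-elim (a≢x (sym e))
... | _ | tri≈ _ e _ | _ = ⊥-elim (b≢x (sym e))
... | _ | _ | tri≈ _ e _ = ⊥-elim (a≢b e)
... | tri< p _ _ | _ | tri< q _ _ = inj₁ (inj₁ (p , q))
... | _ | tri< p _ _ | tri> _ _ q = inj₂ (inj₁ (p , q))
... | tri< p _ _ | tri> _ _ q | tri> _ _ _ = inj₁ (inj₂ (inj₂ (q , p)))
... | tri> _ _ p | tri< q _ _ | tri< _ _ _ = inj₂ (inj₂ (inj₂ (p , q)))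
... | tri> _ _ _ | tri> _ _ q | tri< p _ _ = inj₁ (inj₂ (inj₁ (p , q)))
... | tri> _ _ p | tri> _ _ _ | tri> _ _ q = inj₂ (inj₂ (inj₁ (q , p)))

Increasing : (Fin m → Fin n) → Set
Increasing p = ∀ {i j} → i Fin.< j → p i Fin.< p j

increasing-cyc : {p : Fin m → Fin n} → Increasing p → ∀ {i j l} → Cyc i j l → Cyc (p i) (p j) (p l)
increasing-cyc inc (inj₁ (a , b))        = inj₁ (inc a , inc b)
increasing-cyc inc (inj₂ (inj₁ (a , b))) = inj₂ (inj₁ (inc a , inc b))
increasing-cyc inc (inj₂ (inj₂ (a , b))) = inj₂ (inj₂ (inc a , inc b))

increasing-injective : {p : Fin m → Fin n} → Increasing p → Injective _≡_ _≡_ p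
increasing-injective inc {i} {j} e with Finₚ.<-cmp i j
... | tri< i<j _ _ = ⊥-elim (<-irrefl (cong toℕ e) (inc i<j))
... | tri≈ _ i≡j _ = i≡j
... | tri> _ _ j<i = ⊥-elim (<-irrefl (cong toℕ (sym e)) (inc j<i))

record Embedding (φ : Fin m → Fin n) : Set where
  field
    injective : Injective _≡_ _≡_ φ
    cyclic    : ∀ {i j l} → Cyc i j l → Cyc (φ i) (φ j) (φ l)
open Embedding

embedding : {φ : Fin m → Fin n} → Injective _≡_ _≡_ φ →
  (∀ i j l → i Fin.< j → j Fin.< l → Cyc (φ i) (φ j) (φ l)) → Embedding φ
embedding inj cyc .injective = inj
embedding inj cyc .cyclic (inj₁ (a , b)) = cyc _ _ _ a b
embedding inj cyc .cyclic (inj₂ (inj₁ (a , b))) = cyc-rotate (cyc-rotate (cyc _ _ _ a b))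
embedding inj cyc .cyclic (inj₂ (inj₂ (a , b))) = cyc-rotate (cyc _ _ _ a b)

edge-swap : (H : Hyp n) {x y z : Fin n} → HasEdge H x y z → HasEdge H y x z
edge-swap _ (inj₁ p)                             = inj₂ (inj₂ (inj₁ p))
edge-swap _ (inj₂ (inj₁ p))                      = inj₂ (inj₂ (inj₂ (inj₁ p)))
edge-swap _ (inj₂ (inj₂ (inj₁ p)))               = inj₁ p
edge-swap _ (inj₂ (inj₂ (inj₂ (inj₁ p))))        = inj₂ (inj₁ p)
edge-swap _ (inj₂ (inj₂ (inj₂ (inj₂ (inj₁ p))))) = inj₂ (inj₂ (inj₂ (inj₂ (inj₂ p))))
edge-swap _ (inj₂ (inj₂ (inj₂ (inj₂ (inj₂ p))))) = inj₂ (inj₂ (inj₂ (inj₂ (inj₁ p))))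

edge-rotate : (H : Hyp n) {x y z : Fin n} → HasEdge H x y z → HasEdge H y z x
edge-rotate _ (inj₁ p)                             = inj₂ (inj₂ (inj₂ (inj₂ (inj₁ p))))
edge-rotate _ (inj₂ (inj₁ p))                      = inj₂ (inj₂ (inj₂ (inj₂ (inj₂ p))))
edge-rotate _ (inj₂ (inj₂ (inj₁ p)))               = inj₂ (inj₁ p)
edge-rotate _ (inj₂ (inj₂ (inj₂ (inj₁ p))))        = inj₁ p
edge-rotate _ (inj₂ (inj₂ (inj₂ (inj₂ (inj₁ p))))) = inj₂ (inj₂ (inj₂ (inj₁ p)))
edge-rotate _ (inj₂ (inj₂ (inj₂ (inj₂ (inj₂ p))))) = inj₂ (inj₂ (inj₁ p))

inc-edge : (H : Hyp n) {x y z : Fin n} → Inc x y z → HasEdge H x y z → H x y z ≡ true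
inc-edge _ _       (inj₁ (_ , h))                                  = h
inc-edge _ (_ , q) (inj₂ (inj₁ ((_ , s) , _)))                      = ⊥-elim (<-asym q s)
inc-edge _ (p , _) (inj₂ (inj₂ (inj₁ ((r , _) , _))))               = ⊥-elim (<-asym p r)
inc-edge _ (p , q) (inj₂ (inj₂ (inj₂ (inj₁ ((_ , s) , _)))))        = ⊥-elim (<-asym (<-trans p q) s)
inc-edge _ (p , q) (inj₂ (inj₂ (inj₂ (inj₂ (inj₁ ((r , _) , _)))))) = ⊥-elim (<-asym (<-trans p q) r)
inc-edge _ (p , _) (inj₂ (inj₂ (inj₂ (inj₂ (inj₂ ((_ , s) , _)))))) = ⊥-elim (<-asym p s)

edge-elim : (H : Hyp n) (Q : Fin n → Fin n → Fin n → Set) →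
  (∀ {a b c} → Q a b c → Q b a c) → (∀ {a b c} → Q a b c → Q b c a) →
  (∀ {a b c} → Inc a b c → H a b c ≡ true → Q a b c) → ∀ {x y z} → HasEdge H x y z → Q x y z
edge-elim H Q swap rot base (inj₁ (i , h))                             = base i h
edge-elim H Q swap rot base (inj₂ (inj₁ (i , h)))                      = rot (swap (base i h))
edge-elim H Q swap rot base (inj₂ (inj₂ (inj₁ (i , h))))               = swap (base i h)
edge-elim H Q swap rot base (inj₂ (inj₂ (inj₂ (inj₁ (i , h)))))        = rot (rot (base i h))
edge-elim H Q swap rot base (inj₂ (inj₂ (inj₂ (inj₂ (inj₁ (i , h)))))) = rot (base i h)
edge-elim H Q swap rot base (inj₂ (inj₂ (inj₂ (inj₂ (inj₂ (i , h)))))) = rot (rot (swap (base i h)))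

EdgeAt : Hyp n → (Fin m → Fin n) → Triple m → Set
EdgeAt H p (i , j , l) = HasEdge H (p i) (p j) (p l)

-- The representative i < j < l of a triple of indices that is given in cyclic order.
sort : Triple m → Triple m
sort (a , b , c) =
  if (toℕ a <ᵇ toℕ b) ∧ (toℕ b <ᵇ toℕ c) then a , b , c
  else if (toℕ b <ᵇ toℕ c) ∧ (toℕ c <ᵇ toℕ a) then b , c , a
  else c , a , b

edgeAt-sort⁺ : (H : Hyp n) (p : Fin m → Fin n) (t : Triple m) → EdgeAt H p t → EdgeAt H p (sort t)
edgeAt-sort⁺ H p (a , b , c) h
  with (toℕ a <ᵇ toℕ b) ∧ (toℕ b <ᵇ toℕ c) | (toℕ b <ᵇ toℕ c) ∧ (toℕ c <ᵇ toℕ a)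
... | true  | _     = h
... | false | true  = edge-rotate H h
... | false | false = edge-rotate H (edge-rotate H h)

edgeAt-sort⁻ : (H : Hyp n) (p : Fin m → Fin n) (t : Triple m) → EdgeAt H p (sort t) → EdgeAt H p t
edgeAt-sort⁻ H p (a , b , c) h
  with (toℕ a <ᵇ toℕ b) ∧ (toℕ b <ᵇ toℕ c) | (toℕ b <ᵇ toℕ c) ∧ (toℕ c <ᵇ toℕ a)
... | true  | _     = h
... | false | true  = edge-rotate H (edge-rotate H h)
... | false | false = edge-rotate H h

-- Rotations of the index set of a pattern

prev next : Fin (suc m) → Fin (suc m)
prev zero    = fromℕ _
prev (suc i) = inject₁ i
next i with view i
... | ‵fromℕ     = zero
... | ‵inject₁ j = suc j

next-fromℕ : ∀ m → next (fromℕ m) ≡ zero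
next-fromℕ m rewrite view-fromℕ m = refl

next-inject₁ : (i : Fin m) → next (inject₁ i) ≡ suc i
next-inject₁ i rewrite view-inject₁ i = refl

prev-next : (i : Fin (suc m)) → prev (next i) ≡ i
prev-next i with view i
... | ‵fromℕ     = refl
... | ‵inject₁ j = refl

next-prev : (i : Fin (suc m)) → next (prev i) ≡ i
next-prev zero    = next-fromℕ _
next-prev (suc i) = next-inject₁ i

prev-embedding : Embedding (prev {m})
prev-embedding .injective {i} {j} eq = trans (sym (next-prev i)) (trans (cong next eq) (next-prev j))
prev-embedding .cyclic = embedding (prev-embedding .injective) cyc .cyclic
  where
  inject : {i j : Fin m} → i Fin.< j → inject₁ i Fin.< inject₁ j
  inject = subst₂ _<_ (sym (toℕ-inject₁ _)) (sym (toℕ-inject₁ _))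
  cyc : ∀ i j l → i Fin.< j → j Fin.< l → Cyc (prev i) (prev j) (prev l)
  cyc zero    (suc j) (suc l) _       (s≤s q) =
    inj₂ (inj₁ (inject q , subst₂ _<_ (sym (toℕ-inject₁ _)) (sym (toℕ-fromℕ _)) (toℕ<n l)))
  cyc (suc i) (suc j) (suc l) (s≤s p) (s≤s q) = inj₁ (inject p , inject q)

next-embedding : Embedding (next {m})
next-embedding .injective {i} {j} eq = trans (sym (prev-next i)) (trans (cong prev eq) (prev-next j))
next-embedding .cyclic = embedding (next-embedding .injective) cyc .cyclic
  where
  suc-mono : {i j : Fin m} → inject₁ i Fin.< inject₁ j → Fin.suc i Fin.< suc j
  suc-mono = s≤s ∘ subst₂ _<_ (toℕ-inject₁ _) (toℕ-inject₁ _)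
  bounded : {m : ℕ} {i : Fin (suc m)} → ¬ (fromℕ m Fin.< i)
  bounded {i = i} p = ℕₚ.<⇒≱ (subst (_< toℕ i) (toℕ-fromℕ _) p) (ℕₚ.≤-pred (toℕ<n i))
  cyc : ∀ i j l → i Fin.< j → j Fin.< l → Cyc (next i) (next j) (next l)
  cyc i j l p q with view i | view j | view l
  ... | ‵fromℕ | _ | _ = ⊥-elim (bounded p)
  ... | ‵inject₁ _ | ‵fromℕ | _ = ⊥-elim (bounded q)
  ... | ‵inject₁ _ | ‵inject₁ _ | ‵fromℕ = inj₂ (inj₂ (s≤s z≤n , suc-mono p))
  ... | ‵inject₁ _ | ‵inject₁ _ | ‵inject₁ _ = inj₁ (suc-mono p , suc-mono q)

backward forward : ℕ → Fin (suc m) → Fin (suc m)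
backward ℕ.zero    i = i
backward (suc r) i = backward r (prev i)
forward ℕ.zero    i = i
forward (suc r) i = next (forward r i)

backward-forward : ∀ r (i : Fin (suc m)) → backward r (forward r i) ≡ i
backward-forward ℕ.zero    i = refl
backward-forward (suc r) i = trans (cong (backward r) (prev-next (forward r i))) (backward-forward r i)

forward-backward : ∀ r (i : Fin (suc m)) → forward r (backward r i) ≡ i
forward-backward ℕ.zero    i = refl
forward-backward (suc r) i = trans (cong next (forward-backward r (prev i))) (next-prev i)

backward-self : ∀ r (i : Fin (suc m)) → toℕ i ≡ r → backward r i ≡ zero
backward-self ℕ.zero    zero    _  = refl
backward-self (suc r) (suc i) eq = backward-self r (inject₁ i) (trans (toℕ-inject₁ i) (ℕₚ.suc-injective eq))

backward-embedding : ∀ r → Embedding (backward {m} r)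
backward-embedding ℕ.zero    = record { injective = λ eq → eq ; cyclic = λ c → c }
backward-embedding (suc r) = record
  { injective = prev-embedding .injective ∘ backward-embedding r .injective
  ; cyclic    = backward-embedding r .cyclic ∘ prev-embedding .cyclic }

forward-embedding : ∀ r → Embedding (forward {m} r)
forward-embedding ℕ.zero    = record { injective = λ eq → eq ; cyclic = λ c → c }
forward-embedding (suc r) = record
  { injective = forward-embedding r .injective ∘ next-embedding .injective
  ; cyclic    = next-embedding .cyclic ∘ forward-embedding r .cyclic }

-- Read from its smallest vertex φ r on, a copy φ becomes an increasing sequence; turn r re-indexes the
-- edges of the pattern accordingly.
turn : Fin (suc m) → Triple (suc m) → Triple (suc m)
turn r (a , b , c) = sort (backward (toℕ r) a , backward (toℕ r) b , backward (toℕ r) c)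

argmin : (φ : Fin (suc m) → Fin n) → ∃ λ r → ∀ i → toℕ (φ r) ≤ toℕ (φ i)
argmin {ℕ.zero} φ = zero , λ { zero → ≤-refl }
argmin {suc m} φ with argmin (φ ∘ suc)
... | r , min with ℕₚ.≤-total (toℕ (φ zero)) (toℕ (φ (suc r)))
... | inj₁ le = zero , λ { zero → ≤-refl ; (suc i) → ℕₚ.≤-trans le (min i) }
... | inj₂ ge = suc r , λ { zero → ge ; (suc i) → min i }

-- The cut is made at the index sent to the smallest vertex. Of the three linear orders that a
-- cyclic triple starting there allows, two place another image below this minimum.
embedding-turn : {φ : Fin (suc m) → Fin n} → Embedding φ →
  ∃ λ (r : Fin (suc m)) → Increasing (φ ∘ forward (toℕ r))
embedding-turn {m} {φ = φ} emb with r , min ← argmin φ = r , increasing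
  where
  ρ = forward {m} (toℕ r)
  ρ-zero : ρ zero ≡ r
  ρ-zero = trans (cong ρ (sym (backward-self (toℕ r) r refl))) (forward-backward (toℕ r) r)
  increasing : Increasing (φ ∘ ρ)
  increasing {zero} {j} 0<j with Finₚ.<-cmp (φ (ρ zero)) (φ (ρ j))
  ... | tri< p _ _ = p
  ... | tri≈ _ eq _ = ⊥-elim (<-irrefl (cong toℕ (forward-embedding (toℕ r) .injective (emb .injective eq))) 0<j)
  ... | tri> _ _ p = ⊥-elim (ℕₚ.<⇒≱ p (subst (λ i → toℕ (φ i) ≤ toℕ (φ (ρ j))) (sym ρ-zero) (min (ρ j))))
  increasing {suc i} {j} i<j
    with subst (λ a → Cyc (φ a) (φ (ρ (suc i))) (φ (ρ j))) ρ-zero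
           (emb .cyclic (forward-embedding (toℕ r) .cyclic (inj₁ (s≤s z≤n , i<j))))
  ... | inj₁ (_ , p)        = p
  ... | inj₂ (inj₁ (_ , p)) = ⊥-elim (ℕₚ.<⇒≱ p (min (ρ j)))
  ... | inj₂ (inj₂ (p , _)) = ⊥-elim (ℕₚ.<⇒≱ p (min (ρ j)))

sort-inc : {a b c : Fin m} → Cyc a b c →
  let (i , j , l) = sort (a , b , c) in Inc i j l
sort-inc {a = a} {b} {c} cyc
  with toℕ a <ᵇ toℕ b | ℕₚ.<ᵇ⇒< (toℕ a) (toℕ b) | ℕₚ.<⇒<ᵇ {toℕ a} {toℕ b}
     | toℕ b <ᵇ toℕ c | ℕₚ.<ᵇ⇒< (toℕ b) (toℕ c) | ℕₚ.<⇒<ᵇ {toℕ b} {toℕ c}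
     | toℕ c <ᵇ toℕ a | ℕₚ.<ᵇ⇒< (toℕ c) (toℕ a) | ℕₚ.<⇒<ᵇ {toℕ c} {toℕ a}
... | true  | ab | _ | true  | bc | _ | _     | _  | _ = ab _ , bc _
... | false | _  | _ | true  | bc | _ | true  | ca | _ = bc _ , ca _
sort-inc (inj₁ (p , _)) | false | _ | ab | _ | _ | _ | _ | _ | _ = ⊥-elim (ab p)
sort-inc (inj₁ (_ , p)) | _ | _ | _ | false | _ | bc | _ | _ | _ = ⊥-elim (bc p)
sort-inc (inj₂ (inj₁ (p , _))) | _ | _ | _ | false | _ | bc | _ | _ | _ = ⊥-elim (bc p)
sort-inc (inj₂ (inj₁ (_ , p))) | _ | _ | _ | _ | _ | _ | false | _ | ca = ⊥-elim (ca p)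
sort-inc (inj₂ (inj₂ (_ , p))) | false | _ | ab | _ | _ | _ | _ | _ | _ = ⊥-elim (ab p)
sort-inc (inj₂ (inj₂ (p , _))) | _ | _ | _ | _ | _ | _ | false | _ | ca = ⊥-elim (ca p)
sort-inc (inj₂ (inj₂ p)) | true | _ | _ | false | _ | _ | true | _ | _ = p

-- Copies in natural-number coordinates

Sorted : Triple m → Set
Sorted (a , b , c) = Inc a b c

turn-sorted : (r : Fin (suc m)) (t : Triple (suc m)) → Sorted t → Sorted (turn r t)
turn-sorted r (a , b , c) inc = sort-inc (backward-embedding (toℕ r) .cyclic (inj₁ inc))

sorted? : (t : Triple m) → Dec (Sorted t)
sorted? (a , b , c) = inc? a b c

At : (ℕ → ℕ → ℕ → Set) → (Fin m → ℕ) → Triple m → Set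
At P p (i , j , l) = P (p i) (p j) (p l)

-- Vertices are naturals so that those of a conflict can be written as terms such as `suc a`; the
-- range conditions are collected once, in `Ascending`.
Edge : Hyp n → ℕ → ℕ → ℕ → Set
Edge {n} H a b c = Σ (Triple n) λ (x , y , z) → (toℕ x ≡ a × toℕ y ≡ b × toℕ z ≡ c) × H x y z ≡ true

data Ascending (n : ℕ) : Vec ℕ m → Set where
  [_] : ∀ {a} → a < n → Ascending n (a ∷ [])
  _∷_ : ∀ {a b} {v : Vec ℕ m} → a < b → Ascending n (b ∷ v) → Ascending n (a ∷ b ∷ v)

infixr 5 _∷_

ascending-bounded : {v : Vec ℕ m} → Ascending n v → ∀ i → lookup v i < n
ascending-bounded [ p ]    zero    = p
ascending-bounded (p ∷ ps) zero    = <-trans p (ascending-bounded ps zero)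
ascending-bounded (_ ∷ ps) (suc i) = ascending-bounded ps i

ascending-lookup : {v : Vec ℕ m} → Ascending n v → ∀ {i j} → i Fin.< j → lookup v i < lookup v j
ascending-lookup [ _ ]    {zero}  {suc ()} _
ascending-lookup (p ∷ ps) {zero}  {suc zero}    _       = p
ascending-lookup (p ∷ ps) {zero}  {suc (suc j)} _       = <-trans p (ascending-lookup ps {zero} {suc j} (s≤s z≤n))
ascending-lookup (_ ∷ ps) {suc i} {suc j}       (s≤s q) = ascending-lookup ps q

two-edges : (e f : Triple m) → CGH
two-edges {m} e f = cgh m (e ∷ f ∷ [])

module _ (H : Hyp n) (e f : Triple (suc m)) {se : True (sorted? e)} {sf : True (sorted? f)} where

  private
    back : Fin (suc m) → Triple (suc m) → Triple (suc m)
    back r (a , b , c) = backward (toℕ r) a , backward (toℕ r) b , backward (toℕ r) c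

  -- The pattern point of index `r` is placed on the smallest vertex of `v`; varying `r` gives every
  -- position of the pattern relative to the cut between n - 1 and 0.
  contains-turned : (r : Fin (suc m)) {v : Vec ℕ (suc m)} → Ascending n v →
    At (Edge H) (lookup v) (turn r e) → At (Edge H) (lookup v) (turn r f) → Contains H (two-edges e f)
  contains-turned r {v} asc he hf =
    p ∘ backward (toℕ r) , emb .injective , (λ i j l i<j j<l → emb .cyclic (inj₁ (i<j , j<l))) ,
      edgeAt-sort⁻ H p (back r e) (at (turn r e) (turn-sorted r e (toWitness se)) he) ∷
      edgeAt-sort⁻ H p (back r f) (at (turn r f) (turn-sorted r f (toWitness sf)) hf) ∷ []
    where
    p : Fin (suc m) → Fin n
    p i = fromℕ< (ascending-bounded asc i)
    toℕ-p : ∀ i → toℕ (p i) ≡ lookup v i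
    toℕ-p i = toℕ-fromℕ< _
    inc : Increasing p
    inc q = subst₂ _<_ (sym (toℕ-p _)) (sym (toℕ-p _)) (ascending-lookup asc q)
    emb : Embedding (p ∘ backward (toℕ r))
    emb = record
      { injective = λ eq → backward-embedding (toℕ r) .injective (increasing-injective inc eq)
      ; cyclic    = λ c → increasing-cyc inc (backward-embedding (toℕ r) .cyclic c) }
    at : (t : Triple (suc m)) → Sorted t → At (Edge H) (lookup v) t → EdgeAt H p t
    at (i , j , l) (i<j , j<l) ((x , y , z) , (ex , ey , ez) , h)
      with refl ← toℕ-injective (trans ex (sym (toℕ-p i)))
         | refl ← toℕ-injective (trans ey (sym (toℕ-p j)))
         | refl ← toℕ-injective (trans ez (sym (toℕ-p l)))
      = inj₁ ((inc i<j , inc j<l) , h)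

  free-turned : (P : ℕ → ℕ → ℕ → Set) →
    (∀ a b c → Inc a b c → H a b c ≡ true → P (toℕ a) (toℕ b) (toℕ c)) →
    (∀ r (p : Fin (suc m) → ℕ) → (∀ {i j} → i Fin.< j → p i < p j) → (∀ i → p i < n) →
      At P p (turn r e) → At P p (turn r f) → ⊥) →
    Free H (two-edges e f)
  free-turned P H⊆P avoid (φ , inj , cyc , he ∷ hf ∷ [])
    with r , inc ← embedding-turn {φ = φ} (embedding inj cyc)
    = avoid r (toℕ ∘ φ ∘ forward (toℕ r)) inc (λ _ → toℕ<n _)
        (at inc (turn r e) (turn-sorted r e (toWitness se))
          (edgeAt-sort⁺ H (φ ∘ forward (toℕ r)) (back r e) (moved r e he)))
        (at inc (turn r f) (turn-sorted r f (toWitness sf))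
          (edgeAt-sort⁺ H (φ ∘ forward (toℕ r)) (back r f) (moved r f hf)))
    where
    moved : ∀ r (t : Triple (suc m)) → EdgeAt H φ t → EdgeAt H (φ ∘ forward (toℕ r)) (back r t)
    moved r (a , b , c) h
      rewrite forward-backward (toℕ r) a | forward-backward (toℕ r) b | forward-backward (toℕ r) c = h
    at : {p : Fin (suc m) → Fin n} → Increasing p →
      (t : Triple (suc m)) → Sorted t → EdgeAt H p t → At P (toℕ ∘ p) t
    at {p} inc (i , j , l) (i<j , j<l) h = H⊆P _ _ _ (inc i<j , inc j<l) (inc-edge H (inc i<j , inc j<l) h)

-- Greedy extension

-- The search fixes the value at `zero` and recurses on the rest. A map rebuilt from these pieces
-- agrees with the original only pointwise, hence the transport along `≗`.
any-map? : ∀ m {P : (Fin m → Fin n) → Set} → (∀ {φ ψ} → φ ≗ ψ → P φ → P ψ) → (∀ φ → Dec (P φ)) → Dec (∃ P)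
any-map? ℕ.zero    transport P? = map′ (λ p → _ , p) (λ (φ , p) → transport (λ ()) p) (P? λ ())
any-map? (suc m) {P} transport P? =
  map′ (λ (a , φ , p) → _ , p) (λ (φ , p) → φ zero , φ ∘ suc , transport (λ { zero → refl ; (suc i) → refl }) p)
    (any? λ a → any-map? m (λ eq → transport λ { zero → refl ; (suc i) → eq i }) (λ φ → P? (a Vector.∷ φ)))

hasEdge? : (H : Hyp n) (x y z : Fin n) → Dec (HasEdge H x y z)
hasEdge? H x y z = h x y z ⊎-dec h x z y ⊎-dec h y x z ⊎-dec h y z x ⊎-dec h z x y ⊎-dec h z y x
  where
  h : ∀ x y z → Dec (Inc x y z × H x y z ≡ true)
  h x y z = inc? x y z ×-dec (H x y z Bool.≟ true)

contains? : (H : Hyp n) (F : CGH) → Dec (Contains H F)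
contains? {n} H F = any-map? (F .k) transport λ φ →
  map′ (λ inj → inj _ _) (λ inj _ _ → inj) (all? λ i → all? λ j → (φ i ≟ φ j) →-dec (i ≟ j))
  ×-dec (all? λ i → all? λ j → all? λ l → (i <? j) →-dec ((j <? l) →-dec cyc? _ _ _))
  ×-dec All.all? (λ (a , b , c) → hasEdge? H (φ a) (φ b) (φ c)) (F .edges)
  where
  Copy : (Fin (F .k) → Fin n) → Set
  Copy φ = Injective _≡_ _≡_ φ
    × (∀ i j l → i Fin.< j → j Fin.< l → Cyc (φ i) (φ j) (φ l))
    × All (λ { (a , b , c) → HasEdge H (φ a) (φ b) (φ c) }) (F .edges)
  move : {φ ψ : Fin (F .k) → Fin n} → φ ≗ ψ → (Q : Fin n → Fin n → Fin n → Set) →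
    ∀ a b c → Q (φ a) (φ b) (φ c) → Q (ψ a) (ψ b) (ψ c)
  move eq Q a b c q rewrite eq a | eq b | eq c = q
  transport : ∀ {φ ψ} → φ ≗ ψ → Copy φ → Copy ψ
  transport eq (inj , cyc , es) =
    (λ {i} {j} e → inj (trans (eq i) (trans e (sym (eq j))))) ,
    (λ i j l i<j j<l → move eq Cyc i j l (cyc i j l i<j j<l)) ,
    All.map (λ { {a , b , c} → move eq (HasEdge H) a b c }) es

infix 4 _⊑_
_⊑_ : Hyp n → Hyp n → Set
H ⊑ K = ∀ {a b c} → H a b c ≡ true → K a b c ≡ true

hasEdge-mono : {H K : Hyp n} → H ⊑ K → ∀ {x y z} → HasEdge H x y z → HasEdge K x y z
hasEdge-mono {H = H} {K} H⊑K =
  edge-elim H (HasEdge K) (edge-swap K) (edge-rotate K) (λ i h → inj₁ (i , H⊑K h))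

contains-mono : {H K : Hyp n} {F : CGH} → H ⊑ K → Contains H F → Contains K F
contains-mono {H = H} {K} H⊑K (φ , inj , cyc , es) =
  φ , inj , cyc , All.map (λ { {a , b , c} → hasEdge-mono {H = H} {K} H⊑K }) es

⊑-addEdge : (H : Hyp n) (x y z : Fin n) → H ⊑ addEdge H x y z
⊑-addEdge H x y z h rewrite h = refl

addEdge-new : (H : Hyp n) (x y z : Fin n) → addEdge H x y z x y z ≡ true
addEdge-new H x y z with x ≟ x | y ≟ y | z ≟ z
... | yes _ | yes _ | yes _ = ∨-zeroʳ (H x y z)
... | no x≢ | _     | _     = contradiction refl x≢
... | yes _ | no y≢ | _     = contradiction refl y≢
... | yes _ | yes _ | no z≢ = contradiction refl z≢

addEdge-mono : {H K : Hyp n} → H ⊑ K → ∀ x y z → addEdge H x y z ⊑ addEdge K x y z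
addEdge-mono {H = H} {K} H⊑K x y z {a} {b} {c} h with H a b c in eq
... | true  rewrite H⊑K eq = refl
... | false = trans (cong (K a b c ∨_) h) (∨-zeroʳ (K a b c))

-- One pass is enough: a triple that completes a copy when it is examined still does so in every
-- larger hypergraph.
extend : (F : CGH) (ts : List (Triple n)) (H : Hyp n) → Free H F →
  ∃ λ K → H ⊑ K × Free K F × (∀ {x y z} → (x , y , z) ∈ ts → K x y z ≡ true ⊎ Contains (addEdge K x y z) F)
extend F []                 H free = H , (λ h → h) , free , λ ()
extend F ((x , y , z) ∷ ts) H free with contains? (addEdge H x y z) F
... | yes copy with K , H⊑K , free′ , max ← extend F ts H free =
  K , H⊑K , free′ , λ
    { (here refl) → inj₂ (contains-mono {H = addEdge H x y z} {addEdge K x y z} (addEdge-mono {H = H} {K} H⊑K x y z) copy)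
    ; (there t∈)  → max t∈ }
... | no free₁ with K , H⊑K , free′ , max ← extend F ts (addEdge H x y z) free₁ =
  K , (λ h → H⊑K (⊑-addEdge H x y z h)) , free′ , λ
    { (here refl) → inj₁ (H⊑K (addEdge-new H x y z))
    ; (there t∈)  → max t∈ }

triples : ∀ n → List (Triple n)
triples n = cartesianProduct (allFin n) (cartesianProduct (allFin n) (allFin n))

∈-triples : (t : Triple n) → t ∈ triples n
∈-triples (a , b , c) = ∈-cartesianProduct⁺ (∈-allFin a) (∈-cartesianProduct⁺ (∈-allFin b) (∈-allFin c))

saturate : (F : CGH) (H : Hyp n) → Free H F → ∃ λ K → H ⊑ K × Saturated K F
saturate {n} F H free
  -- The list also contains triples that are not increasing. Setting their values creates no edge,
  -- since `HasEdge` and `size` look only at increasing triples.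
  with K , H⊑K , free′ , max ← extend F (triples n) H free
  = K , H⊑K , free′ , λ x y z _ ¬h → blocked ¬h (max (∈-triples _))
  where
  blocked : ∀ {K : Hyp n} {x y z} → K x y z ≡ false →
    K x y z ≡ true ⊎ Contains (addEdge K x y z) F → Contains (addEdge K x y z) F
  blocked ¬h (inj₁ h) with () ← trans (sym h) ¬h
  blocked ¬h (inj₂ c) = c

-- Counting edges

length-filter-map : {P : Pred B 0ℓ} (P? : Decidable P) (f : A → B) (xs : List A) →
  length (filter P? (map f xs)) ≡ length (filter (P? ∘ f) xs)
length-filter-map P? f []       = refl
length-filter-map P? f (x ∷ xs) with does (P? (f x))
... | true  = cong suc (length-filter-map P? f xs)
... | false = length-filter-map P? f xs

length-filter-cartesianProduct : {P : Pred (A × B) 0ℓ} (P? : Decidable P) (xs : List A) (ys : List B) →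
  length (filter P? (cartesianProduct xs ys)) ≡ sum (map (λ x → length (filter (P? ∘ (x ,_)) ys)) xs)
length-filter-cartesianProduct P? []       ys = refl
length-filter-cartesianProduct P? (x ∷ xs) ys = begin
  length (filter P? (map (x ,_) ys ++ cartesianProduct xs ys))
    ≡⟨ cong length (filter-++ P? (map (x ,_) ys) _) ⟩
  length (filter P? (map (x ,_) ys) ++ filter P? (cartesianProduct xs ys))
    ≡⟨ length-++ (filter P? (map (x ,_) ys)) ⟩
  length (filter P? (map (x ,_) ys)) + length (filter P? (cartesianProduct xs ys))
    ≡⟨ cong₂ _+_ (length-filter-map P? (x ,_) ys) (length-filter-cartesianProduct P? xs ys) ⟩
  _ ∎
  where open ≡-Reasoning

length-filter-sum : {P : Pred A 0ℓ} (P? : Decidable P) (xs : List A) →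
  length (filter P? xs) ≡ sum (map (λ x → if does (P? x) then 1 else 0) xs)
length-filter-sum P? []       = refl
length-filter-sum P? (x ∷ xs) with does (P? x)
... | true  = cong suc (length-filter-sum P? xs)
... | false = length-filter-sum P? xs

isEdge : Hyp n → Triple n → Bool
isEdge H (a , b , c) = ⌊ a <? b ⌋ ∧ ⌊ b <? c ⌋ ∧ H a b c

edgeList : Hyp n → List (Triple n)
edgeList {n} H = filter (T? ∘ isEdge H) (triples n)

length-edgeList : (H : Hyp n) → length (edgeList H) ≡ size H
length-edgeList {n} H = trans (length-filter-cartesianProduct _ (allFin n) _)
  (cong sum (map-cong (λ a → trans (length-filter-cartesianProduct _ (allFin n) _)
    (cong sum (map-cong (λ b → length-filter-sum _ (allFin n)) (allFin n)))) (allFin n)))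

unique-edgeList : (H : Hyp n) → Unique (edgeList H)
unique-edgeList {n} H = Unique.filter⁺ _ (Unique.cartesianProduct⁺ (Unique.allFin⁺ n)
  (Unique.cartesianProduct⁺ (Unique.allFin⁺ n) (Unique.allFin⁺ n)))

isEdge⁺ : (H : Hyp n) {a b c : Fin n} → Inc a b c → H a b c ≡ true → T (isEdge H (a , b , c))
isEdge⁺ H {a} {b} {c} (p , q) h with a <? b | b <? c
... | yes _ | yes _ = Equivalence.from T-≡ h
... | no ¬p | _     = contradiction p ¬p
... | yes _ | no ¬q = contradiction q ¬q

isEdge⁻ : (H : Hyp n) {a b c : Fin n} → T (isEdge H (a , b , c)) → Inc a b c × H a b c ≡ true
isEdge⁻ H {a} {b} {c} t with a <? b | b <? c
... | yes p | yes q = (p , q) , Equivalence.to T-≡ t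

∈-edgeList⁺ : (H : Hyp n) {a b c : Fin n} → Inc a b c → H a b c ≡ true → (a , b , c) ∈ edgeList H
∈-edgeList⁺ H inc h = ∈-filter⁺ (T? ∘ isEdge H) (∈-triples _) (isEdge⁺ H inc h)

∈-edgeList⁻ : (H : Hyp n) {a b c : Fin n} → (a , b , c) ∈ edgeList H → Inc a b c × H a b c ≡ true
∈-edgeList⁻ {n} H t∈ = isEdge⁻ H (proj₂ (∈-filter⁻ (T? ∘ isEdge H) {xs = triples n} t∈))

unique-lookup : {xs : List A} → Unique xs → ∀ i j → List.lookup xs i ≡ List.lookup xs j → i ≡ j
unique-lookup (_ ∷ _)  zero    zero    _  = refl
unique-lookup (x∉ ∷ _) zero    (suc j) eq = contradiction eq (All.lookup x∉ (∈-lookup j))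
unique-lookup (x∉ ∷ _) (suc i) zero    eq = contradiction (sym eq) (All.lookup x∉ (∈-lookup i))
unique-lookup (_ ∷ u)  (suc i) (suc j) eq = cong suc (unique-lookup u i j eq)

injection-≤ : {ys : List B} (f : Fin m → B) → (∀ i j → f i ≡ f j → i ≡ j) → (∀ i → f i ∈ ys) → m ≤ length ys
injection-≤ {ys = ys} f inj f∈ = injective⇒≤ {f = index ∘ f∈} λ {i} {j} eq →
  inj i j (trans (lookup-index (f∈ i)) (trans (cong (List.lookup ys) eq) (sym (lookup-index (f∈ j)))))

size-≤ : (H : Hyp n) {ys : List B} (f : Triple n → B) →
  (∀ {s t} → s ∈ edgeList H → t ∈ edgeList H → f s ≡ f t → s ≡ t) →
  (∀ {t} → t ∈ edgeList H → f t ∈ ys) → size H ≤ length ys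
size-≤ H f inj f∈ = ℕₚ.≤-trans (ℕₚ.≤-reflexive (sym (length-edgeList H)))
  (injection-≤ (f ∘ List.lookup (edgeList H))
    (λ i j eq → unique-lookup (unique-edgeList H) i j (inj (∈-lookup i) (∈-lookup j) eq))
    (λ i → f∈ (∈-lookup i)))

length-cartesianProductWith : (g : A → B → C) (xs : List A) (ys : List B) →
  length (cartesianProductWith g xs ys) ≡ length xs * length ys
length-cartesianProductWith g []       ys = refl
length-cartesianProductWith g (x ∷ xs) ys =
  trans (length-++ (map (g x) ys)) (cong₂ _+_ (length-map (g x) ys) (length-cartesianProductWith g xs ys))

isYes⁻ : (d : Dec A) → ⌊ d ⌋ ≡ true → A
isYes⁻ (yes a) _ = a

isYes⁺ : (d : Dec A) → A → ⌊ d ⌋ ≡ true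
isYes⁺ (yes _) _ = refl
isYes⁺ (no ¬a) a = contradiction a ¬a

ℕ³ : Set
ℕ³ = ℕ × ℕ × ℕ

toℕ³ : Triple n → ℕ³
toℕ³ (a , b , c) = toℕ a , toℕ b , toℕ c

toℕ³-injective : {s t : Triple n} → toℕ³ s ≡ toℕ³ t → s ≡ t
toℕ³-injective eq = cong₂ _,_ (toℕ-injective (cong proj₁ eq))
  (cong₂ _,_ (toℕ-injective (cong (proj₁ ∘ proj₂) eq)) (toℕ-injective (cong (proj₂ ∘ proj₂) eq)))

record EdgeBelow (H : Hyp n) (a b c : ℕ) : Set where
  constructor below
  field
    a<b  : a < b
    b<c  : b < c
    c<n  : c < n
    edge : Edge H a b c

size-≤-list : (H : Hyp n) (ts : List ℕ³) → (∀ {a b c} → EdgeBelow H a b c → (a , b , c) ∈ ts) → size H ≤ length ts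
size-≤-list H ts covered = size-≤ H toℕ³ (λ _ _ → toℕ³-injective) λ t∈ →
  let (a<b , b<c) , h = ∈-edgeList⁻ H t∈ in
  covered (below a<b b<c (toℕ<n _) (_ , (refl , refl , refl) , h))

pattern 0th x = here x
pattern 1st x = there (here x)
pattern 2nd x = there (1st x)
pattern 3rd x = there (2nd x)
pattern 4th x = there (3rd x)
pattern 5th x = there (4th x)
pattern 6th x = there (5th x)
pattern 7th x = there (6th x)
pattern 8th x = there (7th x)

Covered : List (A → B) → List A → B → Set
Covered fs is t = Any (λ f → ∃ λ i → i ∈ is × f i ≡ t) fs

candidates : List (A → B) → List A → List B
candidates = cartesianProductWith (λ f i → f i)

length-candidates : (fs : List (A → B)) (is : List A) → length (candidates fs is) ≡ length fs * length is
length-candidates = length-cartesianProductWith (λ f i → f i)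

covered⇒∈ : (fs : List (A → B)) {is : List A} {t : B} → Covered fs is t → t ∈ candidates fs is
covered⇒∈ fs covered with f , f∈ , i , i∈ , refl ← find covered = ∈-cartesianProductWith⁺ (λ f i → f i) f∈ i∈

-- Overlaps between families are counted repeatedly, so families may be chosen generously; only
-- their number enters the constant.
size-≤-families : (H : Hyp n) (fs : List (A → ℕ³)) (is : List A) →
  (∀ {a b c} → EdgeBelow H a b c → Covered fs is (a , b , c)) →
  size H ≤ length fs * length is
size-≤-families H fs is covered = subst (size H ≤_) (length-candidates fs is)
  (size-≤-list H (candidates fs is) λ e → covered⇒∈ fs (covered e))

module _ {P : ℕ → ℕ → ℕ → Set} (P? : ∀ a b c → Dec (P a b c)) where

  hyp : ∀ n → Hyp n
  hyp n a b c = ⌊ P? (toℕ a) (toℕ b) (toℕ c) ⌋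

  hyp⁻ : ∀ (a b c : Fin n) → hyp n a b c ≡ true → P (toℕ a) (toℕ b) (toℕ c)
  hyp⁻ a b c = isYes⁻ (P? _ _ _)

  hyp⁺ : ∀ {K : Hyp n} → hyp n ⊑ K → ∀ {a b c} → a < b → b < c → c < n → P a b c → Edge K a b c
  hyp⁺ {n} hyp⊑K {a} {b} {c} a<b b<c c<n p =
    (fromℕ< (<-trans a<b (<-trans b<c c<n)) , fromℕ< (<-trans b<c c<n) , fromℕ< c<n) , eqs ,
    hyp⊑K (isYes⁺ (P? _ _ _) (transport eqs p))
    where
    eqs = toℕ-fromℕ< (<-trans a<b (<-trans b<c c<n)) , toℕ-fromℕ< (<-trans b<c c<n) , toℕ-fromℕ< c<n
    transport : ∀ {a b c x y z} → x ≡ a × y ≡ b × z ≡ c → P a b c → P x y z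
    transport (refl , refl , refl) p = p

quadratic : ℕ → List (ℕ × ℕ)
quadratic n = cartesianProduct (upTo n) (upTo n)

length-quadratic : ∀ n → length (quadratic n) ≡ n * n
length-quadratic n = trans (length-cartesianProductWith _ (upTo n) (upTo n)) (cong₂ _*_ (length-upTo n) (length-upTo n))

∈-quadratic : ∀ {i j} → i < n → j < n → (i , j) ∈ quadratic n
∈-quadratic i<n j<n = ∈-cartesianProduct⁺ (∈-upTo⁺ i<n) (∈-upTo⁺ j<n)

gap : {a b c : ℕ} → a < b → b < c → c ≢ suc a
gap a<b b<c refl = <-irrefl refl (≤-trans (s≤s a<b) b<c)

gap₂ : {a b c d : ℕ} → a < b → b < c → c < d → d ≢ suc (suc a)
gap₂ a<b b<c c<d refl = <-irrefl refl (≤-trans (s≤s (≤-trans (s≤s a<b) b<c)) c<d)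

gap₃ : {a b c d e : ℕ} → a < b → b < c → c < d → d < e → e ≢ suc (suc (suc a))
gap₃ a<b b<c c<d d<e refl = <-irrefl refl (≤-trans (s≤s (≤-trans (s≤s (≤-trans (s≤s a<b) b<c)) c<d)) d<e)

-- Upper bounds

Avoids : (ℕ → ℕ → ℕ → Set) → (e f : Triple (suc m)) → Set
Avoids {m} P e f = ∀ r (p : Fin (suc m) → ℕ) → (∀ i j {i<j : True (i Fin.<? j)} → p i < p j) →
  At P p (turn r e) → At P p (turn r f) → ⊥

CopyFree : Hyp n → (e f : Triple (suc m)) → Set
CopyFree {n} {m} H e f = ∀ r {v : Vec ℕ (suc m)} → Ascending n v →
  At (Edge H) (lookup v) (turn r e) → At (Edge H) (lookup v) (turn r f) → ⊥

Includes : Hyp n → (ℕ → ℕ → ℕ → Set) → Set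
Includes {n} H P = ∀ {a b c} → a < b → b < c → c < n → P a b c → Edge H a b c

-- H contains no triple that conflicts with a triple of P, so few families cover it.
upper : (e f : Triple (suc m)) {se : True (sorted? e)} {sf : True (sorted? f)} {P : ℕ → ℕ → ℕ → Set}
  (P? : ∀ a b c → Dec (P a b c)) → Avoids P e f →
  {I : Set} (fs : List (I → ℕ³)) (is : List I) →
  (∀ (H : Hyp n) → CopyFree H e f → Includes H P →
    ∀ {a b c} → a < b → b < c → c < n → Edge H a b c → Covered fs is (a , b , c)) →
  ∃ λ H → Saturated {n} H (two-edges e f) × size H ≤ length fs * length is
upper {n = n} e f {se} {sf} {P} P? avoid fs is cover
  with K , hyp⊑K , sat ← saturate (two-edges e f) (hyp P? n)
    (free-turned (hyp P? n) e f {se} {sf} P (λ a b c _ → hyp⁻ P? a b c)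
      λ r p inc _ → avoid r p λ i j {i<j} → inc (toWitness i<j))
  = K , sat , size-≤-families K fs is λ (below a<b b<c c<n h) →
      cover K (λ r asc he hf → proj₁ sat (contains-turned K e f {se} {sf} r asc he hf)) (hyp⁺ P? hyp⊑K) a<b b<c c<n h

linear-bound : (F : CGH) (C : ℕ) → (∀ n → ∃ λ H → Saturated {n} H F × size H ≤ C * length (upTo n)) → SatUpper F lin
linear-bound F C bound = C , 0 , λ n _ → let H , sat , le = bound n in
  H , sat , subst (λ s → size H ≤ C * s) (length-upTo n) le

quadratic-bound : (F : CGH) (C : ℕ) → (∀ n → ∃ λ H → Saturated {n} H F × size H ≤ C * length (quadratic n)) →
  SatUpper F quad
quadratic-bound F C bound = C , 0 , λ n _ → let H , sat , le = bound n in
  H , sat , subst (λ s → size H ≤ C * s) (length-quadratic n) le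

-- Patterns with a quadratic upper bound

Star : ℕ → ℕ → ℕ → Set
Star a _ _ = a ≡ 0

star? : ∀ a b c → Dec (Star a b c)
star? a _ _ = a ℕ.≟ 0

positive : {a b : ℕ} → a < b → b ≢ 0
positive () refl

upper-M₃ : SatUpper M₃ quad
upper-M₃ = quadratic-bound M₃ 3 λ n →
  upper (u0 , u2 , u4) (u1 , u3 , u5) star? avoid families (quadratic n) cover
  where
  families : List (ℕ × ℕ → ℕ³)
  families = (λ (i , j) → 0 , i , j) ∷ (λ (i , j) → i , suc i , j) ∷ (λ (i , j) → i , j , suc j) ∷ []
  avoid : Avoids Star (u0 , u2 , u4) (u1 , u3 , u5)
  avoid zero                               p inc _ h = positive (inc u0 u1) h
  avoid (suc zero)                         p inc h _ = positive (inc u0 u1) h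
  avoid (suc (suc zero))                   p inc _ h = positive (inc u0 u1) h
  avoid (suc (suc (suc zero)))             p inc h _ = positive (inc u0 u1) h
  avoid (suc (suc (suc (suc zero))))       p inc _ h = positive (inc u0 u1) h
  avoid (suc (suc (suc (suc (suc zero))))) p inc h _ = positive (inc u0 u1) h
  avoid (suc (suc (suc (suc (suc (suc ()))))))
  cover : (H : Hyp n) → CopyFree H (u0 , u2 , u4) (u1 , u3 , u5) → Includes H Star →
    ∀ {a b c} → a < b → b < c → c < n → Edge H a b c → Covered families (quadratic n) (a , b , c)
  cover H no-copy old {0} 0<b b<c c<n e = 0th (_ , ∈-quadratic (<-trans b<c c<n) c<n , refl)
  cover H no-copy old {suc a} a<b b<c c<n e with m≤n⇒m<n∨m≡n a<b | m≤n⇒m<n∨m≡n b<c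
  ... | inj₂ refl | _ = 1st (_ , ∈-quadratic (<-trans a<b (<-trans b<c c<n)) c<n , refl)
  ... | inj₁ _ | inj₂ refl =
    2nd (_ , ∈-quadratic (<-trans a<b (<-trans b<c c<n)) (<-trans b<c c<n) , refl)
  -- The star triple {0, a + 2, b + 1} has one vertex on each of the three arcs cut out by {a + 1,
  -- b, c}; this needs room after a + 1 and after b.
  ... | inj₁ a+1<b | inj₁ b+1<c = ⊥-elim (no-copy zero
      (z<s ∷ ≤-refl ∷ a+1<b ∷ ≤-refl ∷ b+1<c ∷ [ c<n ])
      (old z<s (s≤s a<b) (<-trans b+1<c c<n) refl) e)

-- Star triples meet in 0, while the edges of `M₁` are disjoint. A triple {a, b, c} without 0
-- conflicts with a star triple once three vertices lie outside [a, c]. The exceptions are a = 1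
-- with c = n - 1 or c = n - 2, and a = 2 with c = n - 1.
upper-M₁ : SatUpper M₁ quad
upper-M₁ = quadratic-bound M₁ 4 λ n →
  upper (u0 , u1 , u2) (u3 , u4 , u5) star? avoid (families n) (quadratic n) cover
  where
  families : ℕ → List (ℕ × ℕ → ℕ³)
  families n = (λ (i , j) → 0 , i , j) ∷ (λ (i , j) → 1 , i , n ∸ 1) ∷ (λ (i , j) → 1 , i , n ∸ 2) ∷
    (λ (i , j) → 2 , i , n ∸ 1) ∷ []
  avoid : Avoids Star (u0 , u1 , u2) (u3 , u4 , u5)
  avoid zero                               p inc _ h = positive (inc u0 u3) h
  avoid (suc zero)                         p inc _ h = positive (inc u0 u2) h
  avoid (suc (suc zero))                   p inc _ h = positive (inc u0 u1) h
  avoid (suc (suc (suc zero)))             p inc h _ = positive (inc u0 u3) h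
  avoid (suc (suc (suc (suc zero))))       p inc h _ = positive (inc u0 u2) h
  avoid (suc (suc (suc (suc (suc zero))))) p inc h _ = positive (inc u0 u1) h
  avoid (suc (suc (suc (suc (suc (suc ()))))))
  cover : (H : Hyp n) → CopyFree H (u0 , u1 , u2) (u3 , u4 , u5) → Includes H Star →
    ∀ {a b c} → a < b → b < c → c < n → Edge H a b c → Covered (families n) (quadratic n) (a , b , c)
  cover H no-copy old {0} 0<b b<c c<n e = 0th (_ , ∈-quadratic (<-trans b<c c<n) c<n , refl)
  cover H no-copy old {1} a<b b<c c<n e with m≤n⇒m<n∨m≡n c<n
  -- This family ignores its second parameter; 1 is a dummy value, below n because it is the
  -- smallest vertex of the triple.
  ... | inj₂ refl = 1st (_ , ∈-quadratic {j = 1} (<-trans b<c c<n) (<-trans a<b (<-trans b<c c<n)) , refl)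
  ... | inj₁ c+1<n with m≤n⇒m<n∨m≡n c+1<n
  ...   | inj₂ refl = 2nd (_ , ∈-quadratic {j = 1} (<-trans b<c c<n) (<-trans a<b (<-trans b<c c<n)) , refl)
  ...   | inj₁ c+2<n = ⊥-elim (no-copy u2 (z<s ∷ a<b ∷ b<c ∷ ≤-refl ∷ ≤-refl ∷ [ c+2<n ])
                         (old z<s ≤-refl c+2<n refl) e)
  cover H no-copy old {2} a<b b<c c<n e with m≤n⇒m<n∨m≡n c<n
  ... | inj₂ refl = 3rd (_ , ∈-quadratic {j = 2} (<-trans b<c c<n) (<-trans a<b (<-trans b<c c<n)) , refl)
  ... | inj₁ c+1<n = ⊥-elim (no-copy u1 (z<s ∷ ≤-refl ∷ a<b ∷ b<c ∷ ≤-refl ∷ [ c+1<n ])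
                       (old z<s (s≤s (≤-trans z<s (<-trans a<b b<c))) c+1<n refl) e)
  cover H no-copy old {suc (suc (suc a))} a<b b<c c<n e = ⊥-elim (no-copy zero
    (z<s ∷ ≤-refl ∷ s≤s (s≤s z<s) ∷ a<b ∷ b<c ∷ [ c<n ])
    (old z<s ≤-refl (<-trans (s≤s (s≤s z<s)) (<-trans a<b (<-trans b<c c<n))) refl) e)

even : ℕ → Bool
even 0       = true
even (suc n) = not (even n)

-- If a is even, {a, a + 1, b} conflicts with {a, b, c} whenever b > a + 1; if a is odd, {a - 1, a,
-- c} conflicts with it. The construction is free: in a copy, either a vertex would lie between the
-- two lowest vertices of an edge, or one vertex would be both the upper and the lower end of a pair
-- {2i, 2i + 1}.
upper-D₁ : SatUpper D₁ quad
upper-D₁ = quadratic-bound D₁ 1 λ n →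
  upper (u0 , u1 , u2) (u0 , u2 , u3) even-pair? avoid families (quadratic n) cover
  where
  EvenPair : ℕ → ℕ → ℕ → Set
  EvenPair a b _ = even a ≡ true × b ≡ suc a
  even-pair? : ∀ a b c → Dec (EvenPair a b c)
  even-pair? a b _ = (even a Bool.≟ true) ×-dec (b ℕ.≟ suc a)
  families : List (ℕ × ℕ → ℕ³)
  families = (λ (i , j) → i , suc i , j) ∷ []
  alternating : ∀ {a b} → EvenPair a b 0 → even b ≢ true
  alternating (p , refl) q rewrite p with () ← q
  avoid : Avoids EvenPair (u0 , u1 , u2) (u0 , u2 , u3)
  avoid zero                   p inc _ (_ , h)       = gap (inc u0 u1) (inc u1 u2) h
  avoid (suc zero)             p inc h (h′ , _)      = alternating h h′
  avoid (suc (suc zero))       p inc (_ , h) _       = gap (inc u0 u1) (inc u1 u2) h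
  avoid (suc (suc (suc zero))) p inc (h′ , _) h      = alternating h h′
  avoid (suc (suc (suc (suc ()))))
  cover : (H : Hyp n) → CopyFree H (u0 , u1 , u2) (u0 , u2 , u3) → Includes H EvenPair →
    ∀ {a b c} → a < b → b < c → c < n → Edge H a b c → Covered families (quadratic n) (a , b , c)
  cover H no-copy old {a} a<b b<c c<n e with m≤n⇒m<n∨m≡n a<b
  ... | inj₂ refl = 0th (_ , ∈-quadratic (<-trans a<b (<-trans b<c c<n)) c<n , refl)
  ... | inj₁ a+1<b with even a in ev
  cover H no-copy old {a}     a<b b<c c<n e | inj₁ a+1<b | true  =
    ⊥-elim (no-copy zero (≤-refl ∷ a+1<b ∷ b<c ∷ [ c<n ]) (old ≤-refl a+1<b (<-trans b<c c<n) (ev , refl)) e)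
  cover H no-copy old {suc a} a<b b<c c<n e | inj₁ a+1<b | false =
    ⊥-elim (no-copy u1 (≤-refl ∷ a<b ∷ b<c ∷ [ c<n ]) (old ≤-refl (<-trans a<b b<c) c<n (not-injective ev , refl)) e)

-- The two smallest vertices of an edge determine the third, since {a, b, c} and {a, b, d} with a <
-- b < c < d form a copy. The extension can thus start from the empty hypergraph.
upper-D₂ : SatUpper D₂ quad
upper-D₂ = 1 , 0 , λ n _ →
  let K , _ , sat = saturate D₂ (λ _ _ _ → false) (no-edges n) in
  K , sat , ℕₚ.≤-trans (pairs-determine K (proj₁ sat))
    (ℕₚ.≤-reflexive (trans (length-cartesianProductWith _ (allFin n) (allFin n))
      (trans (cong₂ _*_ (length-tabulate {n = n} _) (length-tabulate {n = n} _)) (sym (ℕₚ.*-identityˡ (n * n))))))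
  where
  no-edges : ∀ n → Free {n} (λ _ _ _ → false) D₂
  no-edges n = free-turned (λ _ _ _ → false) (u0 , u1 , u2) (u0 , u1 , u3) (λ _ _ _ → ⊥) (λ _ _ _ _ ()) λ _ _ _ _ ()
  third : {H : Hyp n} → Free H D₂ → ∀ {a b c d} → Inc a b c → H a b c ≡ true → Inc a b d → H a b d ≡ true → ¬ c Fin.< d
  third {H = H} free (a<b , b<c) h _ h′ c<d = free (contains-turned H (u0 , u1 , u2) (u0 , u1 , u3) zero
    (a<b ∷ b<c ∷ c<d ∷ [ toℕ<n _ ]) (_ , (refl , refl , refl) , h) (_ , (refl , refl , refl) , h′))
  pairs-determine : (H : Hyp n) → Free H D₂ → size H ≤ length (cartesianProduct (allFin n) (allFin n))
  pairs-determine {n} H free = size-≤ H (λ (a , b , _) → a , b) unique (λ _ → ∈-cartesianProduct⁺ (∈-allFin _) (∈-allFin _))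
    where
    unique : ∀ {s t} → s ∈ edgeList H → t ∈ edgeList H → (proj₁ s , proj₁ (proj₂ s)) ≡ (proj₁ t , proj₁ (proj₂ t)) → s ≡ t
    unique {a , b , c} {_ , _ , d} s∈ t∈ refl
      with ∈-edgeList⁻ H s∈ | ∈-edgeList⁻ H t∈ | Finₚ.<-cmp c d
    ... | i , h | j , h′ | tri< c<d _ _  = contradiction c<d (third free i h j h′)
    ... | _     | _      | tri≈ _ refl _ = refl
    ... | i , h | j , h′ | tri> _ _ d<c  = contradiction d<c (third free j h′ i h)

-- Patterns with a linear upper bound

below-or-last : ∀ {c n} → c < n → suc c < n ⊎ c ≡ n ∸ 1
below-or-last {c} {n} c<n with m≤n⇒m<n∨m≡n c<n
... | inj₁ c+1<n = inj₁ c+1<n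
... | inj₂ refl  = inj₂ refl

-- A run of three vertices leaves two of its arcs empty, but in `S₁` two arcs of {u0, u2, u3}
-- contain a vertex. The run centred at a conflicts with {a, b, c} unless a = 0 or b = a + 1, and
-- the run centred at c does unless c = b + 1 or c = n - 1. Two by two choices remain.
upper-S₁ : SatUpper S₁ lin
upper-S₁ = linear-bound S₁ 4 λ n →
  upper (u0 , u1 , u4) (u0 , u2 , u3) consecutive? avoid (families n) (upTo n) cover
  where
  Consecutive : ℕ → ℕ → ℕ → Set
  Consecutive a b c = b ≡ suc a × c ≡ suc (suc a)
  consecutive? : ∀ a b c → Dec (Consecutive a b c)
  consecutive? a b c = (b ℕ.≟ suc a) ×-dec (c ℕ.≟ suc (suc a))
  families : ℕ → List (ℕ → ℕ³)
  families n = (λ i → 0 , i , suc i) ∷ (λ i → 0 , i , n ∸ 1) ∷ (λ i → i , suc i , suc (suc i)) ∷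
    (λ i → i , suc i , n ∸ 1) ∷ []
  avoid : Avoids Consecutive (u0 , u1 , u4) (u0 , u2 , u3)
  avoid zero                         p inc _ (h , _) = gap (inc u0 u1) (inc u1 u2) h
  avoid (suc zero)                   p inc (h , _) _ = gap (inc u0 u1) (inc u1 u3) h
  avoid (suc (suc zero))             p inc _ (_ , h) = gap₂ (inc u0 u1) (inc u1 u2) (inc u2 u3) h
  avoid (suc (suc (suc zero)))       p inc _ (h , _) = gap (inc u0 u1) (inc u1 u2) h
  avoid (suc (suc (suc (suc zero)))) p inc _ (h , _) = gap (inc u1 u2) (inc u2 u3) h
  avoid (suc (suc (suc (suc (suc ())))))
  cover : (H : Hyp n) → CopyFree H (u0 , u1 , u4) (u0 , u2 , u3) → Includes H Consecutive →
    ∀ {a b c} → a < b → b < c → c < n → Edge H a b c → Covered (families n) (upTo n) (a , b , c)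
  cover {n} H no-copy old {a} {b} {c} a<b b<c c<n e = combine (left a<b e) (right b<c c<n e)
    where
    left : ∀ {a} → a < b → Edge H a b c → a ≡ 0 ⊎ b ≡ suc a
    left {0}     _   _ = inj₁ refl
    left {suc a} a<b e with m≤n⇒m<n∨m≡n a<b
    ... | inj₂ refl  = inj₂ refl
    ... | inj₁ a+1<b = ⊥-elim (no-copy u4 (≤-refl ∷ ≤-refl ∷ a+1<b ∷ b<c ∷ [ c<n ])
                         (old ≤-refl ≤-refl (<-trans a+1<b (<-trans b<c c<n)) (refl , refl)) e)
    right : ∀ {c} → b < c → c < n → Edge H a b c → c ≡ suc b ⊎ c ≡ n ∸ 1
    right {suc c} b<c c<n e with below-or-last c<n | m≤n⇒m<n∨m≡n b<c
    ... | inj₂ eq    | _              = inj₂ eq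
    ... | inj₁ _     | inj₂ refl      = inj₁ refl
    ... | inj₁ c+1<n | inj₁ (s≤s b<c) = ⊥-elim (no-copy u2 (a<b ∷ b<c ∷ ≤-refl ∷ ≤-refl ∷ [ c+1<n ])
                         (old ≤-refl ≤-refl c+1<n (refl , refl)) e)
    a∈ = ∈-upTo⁺ (<-trans a<b (<-trans b<c c<n))
    b∈ = ∈-upTo⁺ (<-trans b<c c<n)
    combine : a ≡ 0 ⊎ b ≡ suc a → c ≡ suc b ⊎ c ≡ n ∸ 1 → Covered (families n) (upTo n) (a , b , c)
    combine (inj₁ refl) (inj₁ refl) = 0th (_ , b∈ , refl)
    combine (inj₁ refl) (inj₂ eq)   = 1st (_ , b∈ , cong (λ z → 0 , b , z) (sym eq))
    combine (inj₂ refl) (inj₁ refl) = 2nd (_ , a∈ , refl)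
    combine (inj₂ refl) (inj₂ eq)   = 3rd (_ , a∈ , cong (λ z → a , suc a , z) (sym eq))

-- In the second edge of `M₂` only the arc from u4 to u5 can be empty, and the arc after it contains
-- u0 and u1. In {a, a + 1, a + 3} the arc after the empty one has a single vertex, so such a triple
-- can only be a first edge and no two of them conflict. Another triple {a, b, c} conflicts with the
-- one that starts at a - 2 or at c - 2, whose gap is a or c, unless this does not fit: three by
-- three choices remain.
upper-M₂ : SatUpper M₂ lin
upper-M₂ = linear-bound M₂ 9 λ n →
  upper (u0 , u1 , u3) (u2 , u4 , u5) near? avoid (families n) (upTo n) cover
  where
  Near : ℕ → ℕ → ℕ → Set
  Near a b c = b ≡ suc a × c ≡ suc (suc (suc a))
  near? : ∀ a b c → Dec (Near a b c)
  near? a b c = (b ℕ.≟ suc a) ×-dec (c ℕ.≟ suc (suc (suc a)))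
  families : ℕ → List (ℕ → ℕ³)
  families n = (λ i → 0 , i , 1 + i) ∷ (λ i → 0 , i , 2 + i) ∷ (λ i → 0 , i , n ∸ 1) ∷
    (λ i → 1 , i , 1 + i) ∷ (λ i → 1 , i , 2 + i) ∷ (λ i → 1 , i , n ∸ 1) ∷
    (λ i → i , 1 + i , 2 + i) ∷ (λ i → i , 1 + i , 3 + i) ∷ (λ i → i , 1 + i , n ∸ 1) ∷ []
  avoid : Avoids Near (u0 , u1 , u3) (u2 , u4 , u5)
  avoid zero                               p inc _ (h , _) = gap (inc u2 u3) (inc u3 u4) h
  avoid (suc zero)                         p inc (h , _) _ = gap (inc u0 u1) (inc u1 u2) h
  avoid (suc (suc zero))                   p inc (h , _) _ = gap (inc u1 u2) (inc u2 u4) h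
  avoid (suc (suc (suc zero)))             p inc (h , _) _ = gap (inc u0 u1) (inc u1 u3) h
  avoid (suc (suc (suc (suc zero))))       p inc _ (_ , h) = gap₃ (inc u0 u1) (inc u1 u2) (inc u2 u3) (inc u3 u4) h
  avoid (suc (suc (suc (suc (suc zero))))) p inc _ (h , _) = gap (inc u0 u1) (inc u1 u3) h
  avoid (suc (suc (suc (suc (suc (suc ()))))))
  cover : (H : Hyp n) → CopyFree H (u0 , u1 , u3) (u2 , u4 , u5) → Includes H Near →
    ∀ {a b c} → a < b → b < c → c < n → Edge H a b c → Covered (families n) (upTo n) (a , b , c)
  cover {n} H no-copy old {a} {b} {c} a<b b<c c<n e = combine (left a<b e) (right b<c c<n e)
    where
    left : ∀ {a} → a < b → Edge H a b c → a ≡ 0 ⊎ a ≡ 1 ⊎ b ≡ suc a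
    left {0}           _   _ = inj₁ refl
    left {1}           _   _ = inj₂ (inj₁ refl)
    left {suc (suc a)} a<b e with m≤n⇒m<n∨m≡n a<b
    ... | inj₂ refl  = inj₂ (inj₂ refl)
    ... | inj₁ a+1<b = ⊥-elim (no-copy zero (≤-refl ∷ ≤-refl ∷ ≤-refl ∷ a+1<b ∷ b<c ∷ [ c<n ])
                         (old ≤-refl (ℕₚ.m≤n⇒m≤1+n ≤-refl) (<-trans a+1<b (<-trans b<c c<n)) (refl , refl)) e)
    right : ∀ {c} → b < c → c < n → Edge H a b c → c ≡ 1 + b ⊎ c ≡ 2 + b ⊎ c ≡ n ∸ 1
    right {suc c} b<c c<n e with below-or-last c<n | m≤n⇒m<n∨m≡n b<c
    ... | inj₂ eq    | _               = inj₂ (inj₂ eq)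
    ... | inj₁ _     | inj₂ refl       = inj₁ refl
    right {suc (suc c)} b<c c<n e | inj₁ c+1<n | inj₁ (s≤s b<c′) with m≤n⇒m<n∨m≡n b<c′
    ... | inj₂ refl      = inj₂ (inj₁ refl)
    ... | inj₁ (s≤s b<c″) = ⊥-elim (no-copy u4 (a<b ∷ b<c″ ∷ ≤-refl ∷ ≤-refl ∷ ≤-refl ∷ [ c+1<n ])
                         (old ≤-refl (ℕₚ.m≤n⇒m≤1+n ≤-refl) c+1<n (refl , refl)) e)
    a∈ = ∈-upTo⁺ (<-trans a<b (<-trans b<c c<n))
    b∈ = ∈-upTo⁺ (<-trans b<c c<n)
    combine : a ≡ 0 ⊎ a ≡ 1 ⊎ b ≡ suc a → c ≡ 1 + b ⊎ c ≡ 2 + b ⊎ c ≡ n ∸ 1 →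
      Covered (families n) (upTo n) (a , b , c)
    combine (inj₁ refl)        (inj₁ refl)        = 0th (_ , b∈ , refl)
    combine (inj₁ refl)        (inj₂ (inj₁ refl)) = 1st (_ , b∈ , refl)
    combine (inj₁ refl)        (inj₂ (inj₂ eq))   = 2nd (_ , b∈ , cong (λ z → 0 , b , z) (sym eq))
    combine (inj₂ (inj₁ refl)) (inj₁ refl)        = 3rd (_ , b∈ , refl)
    combine (inj₂ (inj₁ refl)) (inj₂ (inj₁ refl)) = 4th (_ , b∈ , refl)
    combine (inj₂ (inj₁ refl)) (inj₂ (inj₂ eq))   = 5th (_ , b∈ , cong (λ z → 1 , b , z) (sym eq))
    combine (inj₂ (inj₂ refl)) (inj₁ refl)        = 6th (_ , a∈ , refl)
    combine (inj₂ (inj₂ refl)) (inj₂ (inj₁ refl)) = 7th (_ , a∈ , refl)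
    combine (inj₂ (inj₂ refl)) (inj₂ (inj₂ eq))   = 8th (_ , a∈ , cong (λ z → a , suc a , z) (sym eq))

-- Marks 0, 1, 4, 5, 8, 9, ...
start : ℕ → Bool
start 0             = true
start 1             = true
start (suc (suc a)) = not (start a)

-- Two blocks in a copy would share the last vertex of one and the first of the other, but a and a +
-- 2 are never both starts. For a triple {a, b, c}, a block ending at a always conflicts, and one
-- starting at a does unless b ≤ a + 2. A block starting at c conflicts unless c ≥ n - 2, and one
-- ending at c unless c ≤ b + 2.
upper-S₂ : SatUpper S₂ lin
upper-S₂ = linear-bound S₂ 8 λ n →
  upper (u0 , u1 , u2) (u0 , u3 , u4) block? avoid (families n) (upTo n) cover
  where
  Block : ℕ → ℕ → ℕ → Set
  Block a b c = start a ≡ true × b ≡ suc a × c ≡ suc (suc a)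
  block? : ∀ a b c → Dec (Block a b c)
  block? a b c = (start a Bool.≟ true) ×-dec (b ℕ.≟ suc a) ×-dec (c ℕ.≟ suc (suc a))
  families : ℕ → List (ℕ → ℕ³)
  families n = (λ i → i , 1 + i , 2 + i) ∷ (λ i → i , 1 + i , 3 + i) ∷
    (λ i → i , 1 + i , n ∸ 1) ∷ (λ i → i , 1 + i , n ∸ 2) ∷
    (λ i → i , 2 + i , 3 + i) ∷ (λ i → i , 2 + i , 4 + i) ∷
    (λ i → i , 2 + i , n ∸ 1) ∷ (λ i → i , 2 + i , n ∸ 2) ∷ []
  not-both : ∀ {a b} → start a ≡ true → b ≡ suc (suc a) → start b ≢ true
  not-both p refl q rewrite p with () ← q
  avoid : Avoids Block (u0 , u1 , u2) (u0 , u3 , u4)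
  avoid zero                         p inc _ (_ , h , _) = gap (inc u0 u1) (inc u1 u3) h
  avoid (suc zero)                   p inc (_ , _ , h) _ = gap₂ (inc u0 u1) (inc u1 u2) (inc u2 u4) h
  avoid (suc (suc zero))             p inc (_ , h , _) _ = gap (inc u0 u1) (inc u1 u3) h
  avoid (suc (suc (suc zero)))       p inc (h , _) (h′ , _ , eq) = not-both h′ eq h
  avoid (suc (suc (suc (suc zero)))) p inc _ (_ , _ , h) = gap₂ (inc u0 u1) (inc u1 u2) (inc u2 u4) h
  avoid (suc (suc (suc (suc (suc ())))))
  -- Every v is the first or the last vertex of a block.
  block-at : ∀ v → start v ≡ true ⊎ ∃ λ a → v ≡ suc (suc a) × start a ≡ true
  block-at v with start v in eq
  ... | true = inj₁ refl
  block-at (suc (suc a)) | false = inj₂ (a , refl , not-injective eq)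
  cover : (H : Hyp n) → CopyFree H (u0 , u1 , u2) (u0 , u3 , u4) → Includes H Block →
    ∀ {a b c} → a < b → b < c → c < n → Edge H a b c → Covered (families n) (upTo n) (a , b , c)
  cover {n} H no-copy old {a} {b} {c} a<b b<c c<n e = combine (left (block-at a)) (right (block-at c))
    where
    left : start a ≡ true ⊎ (∃ λ a′ → a ≡ suc (suc a′) × start a′ ≡ true) → b ≡ 1 + a ⊎ b ≡ 2 + a
    left (inj₁ st) with m≤n⇒m<n∨m≡n a<b
    ... | inj₂ refl = inj₁ refl
    ... | inj₁ a+1<b with m≤n⇒m<n∨m≡n a+1<b
    ...   | inj₂ refl = inj₂ refl
    ...   | inj₁ a+2<b = ⊥-elim (no-copy zero (≤-refl ∷ ≤-refl ∷ a+2<b ∷ b<c ∷ [ c<n ])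
                           (old ≤-refl ≤-refl (<-trans a+2<b (<-trans b<c c<n)) (st , refl , refl)) e)
    left (inj₂ (a′ , refl , st)) = ⊥-elim (no-copy u3 (≤-refl ∷ ≤-refl ∷ a<b ∷ b<c ∷ [ c<n ]) e
                           (old ≤-refl ≤-refl (<-trans a<b (<-trans b<c c<n)) (st , refl , refl)))
    right : start c ≡ true ⊎ (∃ λ c′ → c ≡ suc (suc c′) × start c′ ≡ true) →
      (c ≡ 1 + b ⊎ c ≡ 2 + b) ⊎ (c ≡ n ∸ 1 ⊎ c ≡ n ∸ 2)
    right (inj₁ st) with m≤n⇒m<n∨m≡n c<n
    ... | inj₂ refl  = inj₂ (inj₁ refl)
    ... | inj₁ c+1<n with m≤n⇒m<n∨m≡n c+1<n
    ...   | inj₂ refl  = inj₂ (inj₂ refl)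
    ...   | inj₁ c+2<n = ⊥-elim (no-copy u3 (a<b ∷ b<c ∷ ≤-refl ∷ ≤-refl ∷ [ c+2<n ])
                           (old ≤-refl ≤-refl c+2<n (st , refl , refl)) e)
    right (inj₂ (c′ , refl , st)) with m≤n⇒m<n∨m≡n b<c
    ... | inj₂ refl = inj₁ (inj₁ refl)
    ... | inj₁ (s≤s b<c′+1) with m≤n⇒m<n∨m≡n b<c′+1
    ...   | inj₂ refl       = inj₁ (inj₂ refl)
    ...   | inj₁ (s≤s b<c′) = ⊥-elim (no-copy u1 (a<b ∷ b<c′ ∷ ≤-refl ∷ ≤-refl ∷ [ c<n ]) e
                           (old ≤-refl ≤-refl c<n (st , refl , refl)))
    a∈ = ∈-upTo⁺ (<-trans a<b (<-trans b<c c<n))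
    combine : b ≡ 1 + a ⊎ b ≡ 2 + a → (c ≡ 1 + b ⊎ c ≡ 2 + b) ⊎ (c ≡ n ∸ 1 ⊎ c ≡ n ∸ 2) →
      Covered (families n) (upTo n) (a , b , c)
    combine (inj₁ refl) (inj₁ (inj₁ refl)) = 0th (_ , a∈ , refl)
    combine (inj₁ refl) (inj₁ (inj₂ refl)) = 1st (_ , a∈ , refl)
    combine (inj₁ refl) (inj₂ (inj₁ eq))   = 2nd (_ , a∈ , cong (λ z → a , b , z) (sym eq))
    combine (inj₁ refl) (inj₂ (inj₂ eq))   = 3rd (_ , a∈ , cong (λ z → a , b , z) (sym eq))
    combine (inj₂ refl) (inj₁ (inj₁ refl)) = 4th (_ , a∈ , refl)
    combine (inj₂ refl) (inj₁ (inj₂ refl)) = 5th (_ , a∈ , refl)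
    combine (inj₂ refl) (inj₂ (inj₁ eq))   = 6th (_ , a∈ , cong (λ z → a , b , z) (sym eq))
    combine (inj₂ refl) (inj₂ (inj₂ eq))   = 7th (_ , a∈ , cong (λ z → a , b , z) (sym eq))

-- The upper bound for S₃

data Tree : ℕ → Set where
  leaf  : Tree 0
  point : Tree 1
  split : ∀ {l r} → Tree l → Tree r → Tree (2 + (l + r))

-- A tree of size s placed at p splits the interval [p, p + s) into its two endpoints and two
-- subintervals; Node t p a c says that [a, c] is one of the split intervals.
Node : ∀ {s} → Tree s → ℕ → ℕ → ℕ → Set
Node leaf                  p a c = ⊥
Node point                 p a c = ⊥
Node (split {l} {r} L R) p a c = (a ≡ p × c ≡ suc (p + l + r)) ⊎ Node L (suc p) a c ⊎ Node R (suc p + l) a c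

node? : ∀ {s} (t : Tree s) p a c → Dec (Node t p a c)
node? leaf                p a c = no λ ()
node? point               p a c = no λ ()
node? (split {l} {r} L R) p a c =
  ((a ℕ.≟ p) ×-dec (c ℕ.≟ suc (p + l + r))) ⊎-dec node? L (suc p) a c ⊎-dec node? R (suc p + l) a c

split-end : ∀ p l r → p + (2 + (l + r)) ≡ 2 + (p + l + r)
split-end = solve 3 (λ p l r → p :+ (con 2 :+ (l :+ r)) := con 2 :+ (p :+ l :+ r)) refl
  where open +-*-Solver

node-bounds : ∀ {s} (t : Tree s) {p a c} → Node t p a c → p ≤ a × c < p + s
node-bounds (split {l} {r} L R) {p} (inj₁ (refl , refl)) =
  ≤-refl , ℕₚ.≤-reflexive (sym (split-end p l r))
node-bounds (split {l} {r} L R) {p} (inj₂ (inj₁ h)) with lo , hi ← node-bounds L h =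
  ℕₚ.<⇒≤ lo , ≤-trans hi (≤-trans (s≤s (ℕₚ.≤-trans (ℕₚ.m≤m+n (p + l) r) (ℕₚ.n≤1+n _))) (ℕₚ.≤-reflexive (sym (split-end p l r))))
node-bounds (split {l} {r} L R) {p} (inj₂ (inj₂ h)) with lo , hi ← node-bounds R h =
  ≤-trans (ℕₚ.m≤m+n p l) (ℕₚ.<⇒≤ lo) ,
  ≤-trans hi (≤-trans (s≤s (ℕₚ.n≤1+n _)) (ℕₚ.≤-reflexive (sym (split-end p l r))))

-- Split intervals are nested or disjoint and have distinct endpoints. In every rotation of `S₃`,
-- the intervals spanned by the two edges cross or share an endpoint, so this excludes all copies,
-- whatever the middle vertices are.
node-unique : ∀ {s} (t : Tree s) {p a c a′ c′} → Node t p a c → Node t p a′ c′ →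
  a ≤ a′ → a′ ≤ c → c ≤ c′ → a ≡ a′ × c ≡ c′
node-unique (split {l} {r} L R) {p} h h′ a≤a′ a′≤c c≤c′ = cases h h′
  where
  cases : _ → _ → _
  cases (inj₁ (refl , refl)) (inj₁ (refl , refl)) = refl , refl
  cases (inj₁ (refl , refl)) (inj₂ (inj₁ h′)) =
    ⊥-elim (ℕₚ.<⇒≱ (proj₂ (node-bounds L h′)) (≤-trans (s≤s (ℕₚ.m≤m+n (p + l) r)) c≤c′))
  cases (inj₁ (refl , refl)) (inj₂ (inj₂ h′)) = ⊥-elim (ℕₚ.<⇒≱ (proj₂ (node-bounds R h′)) c≤c′)
  cases (inj₂ (inj₁ h)) (inj₁ (refl , refl)) = ⊥-elim (ℕₚ.<⇒≱ (proj₁ (node-bounds L h)) a≤a′)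
  cases (inj₂ (inj₁ h)) (inj₂ (inj₁ h′)) = node-unique L h h′ a≤a′ a′≤c c≤c′
  cases (inj₂ (inj₁ h)) (inj₂ (inj₂ h′)) =
    ⊥-elim (ℕₚ.<⇒≱ (proj₂ (node-bounds L h)) (≤-trans (proj₁ (node-bounds R h′)) a′≤c))
  cases (inj₂ (inj₂ h)) (inj₁ (refl , refl)) =
    ⊥-elim (ℕₚ.<⇒≱ (≤-trans (s≤s (ℕₚ.m≤m+n p l)) (proj₁ (node-bounds R h))) a≤a′)
  cases (inj₂ (inj₂ h)) (inj₂ (inj₁ h′)) =
    ⊥-elim (ℕₚ.<⇒≱ (proj₂ (node-bounds L h′)) (≤-trans (proj₁ (node-bounds R h)) (≤-trans a≤a′ (≤-trans a′≤c c≤c′))))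
  cases (inj₂ (inj₂ h)) (inj₂ (inj₂ h′)) = node-unique R h h′ a≤a′ a′≤c c≤c′

root : ∀ {s} (t : Tree s) {p x y} → p ≤ x → x < y → y < p + s → ∃ λ q → Node t p p q × suc q ≡ p + s
root leaf  {p} p≤x x<y y<p = contradiction (≤-trans p≤x (ℕₚ.<⇒≤ x<y)) (ℕₚ.<⇒≱ (subst (_ <_) (ℕₚ.+-identityʳ p) y<p))
root point {p} {y = y} p≤x x<y y<p+1 =
  contradiction (≤-trans (s≤s p≤x) x<y) (ℕₚ.<⇒≱ (subst (y <_) (ℕₚ.+-comm p 1) y<p+1))
root (split {l} {r} L R) {p} _ _ _ = _ , inj₁ (refl , refl) , sym (split-end p l r)

-- Three groups of three: triples using an end of the split interval, triples with just two vertices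
-- in the left part, and triples with just two in the right part.
split-families : (p l r : ℕ) → List (ℕ → ℕ³)
split-families p l r =
    (λ i → p , i , suc (p + l + r)) ∷ (λ i → p , i , suc i) ∷ (λ i → i , suc i , suc (p + l + r))
  ∷ (λ i → suc p , p + l , i) ∷ (λ i → suc p , suc (suc p) , i) ∷ (λ i → ℕ.pred (p + l) , p + l , i)
  ∷ (λ i → i , suc p + l , p + l + r) ∷ (λ i → i , suc p + l , suc (suc p + l)) ∷ (λ i → i , ℕ.pred (p + l + r) , p + l + r)
  ∷ []

interval : ℕ → ℕ → List ℕ
interval p s = map (p +_) (upTo s)

∈-interval : ∀ {p s i} → p ≤ i → i < p + s → i ∈ interval p s
∈-interval {p} {s} {i} p≤i i<p+s = subst (_∈ interval p s) (ℕₚ.m+[n∸m]≡n p≤i)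
  (∈-map⁺ (p +_) (∈-upTo⁺ (ℕₚ.+-cancelˡ-< p _ _ (subst (_< p + s) (sym (ℕₚ.m+[n∸m]≡n p≤i)) i<p+s))))

unblocked : ∀ {s} → Tree s → ℕ → List ℕ³
unblocked leaf                p = []
unblocked point               p = []
unblocked (split {l} {r} L R) p =
  candidates (split-families p l r) (interval p (2 + (l + r))) ++ unblocked L (suc p) ++ unblocked R (suc p + l)

module _ (H : Hyp n) (no-copy : CopyFree {m = 4} H (u0 , u1 , u3) (u0 , u2 , u4)) where

  -- Triples inside one part are passed down. A straddling triple has exactly two vertices in one
  -- part; the root interval of that part blocks it unless the two are both endpoints, or are
  -- consecutive and include one. A triple with just one end of [p, q] is blocked by [p, q] unless
  -- its other two vertices are consecutive.
  unblocked-complete : ∀ {s} (t : Tree s) p → p + s ≤ n →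
    (∀ {a b c} → Node t p a c → a < b → b < c → Edge H a b c) →
    ∀ {x y z} → Edge H x y z → p ≤ x → x < y → y < z → z < p + s → (x , y , z) ∈ unblocked t p
  unblocked-complete leaf  p _ _ _ p≤x x<y y<z z<p =
    contradiction (≤-trans p≤x (ℕₚ.<⇒≤ (<-trans x<y y<z))) (ℕₚ.<⇒≱ (subst (_ <_) (ℕₚ.+-identityʳ p) z<p))
  unblocked-complete point p _ _ {z = z} _ p≤x x<y y<z z<p+1 =
    contradiction (≤-trans (s≤s p≤x) (<-trans x<y y<z)) (ℕₚ.<⇒≱ (subst (z <_) (ℕₚ.+-comm p 1) z<p+1))
  unblocked-complete (split {l} {r} L R) p bound old {x} {y} {z} e p≤x x<y y<z z<end =
    outer (m≤n⇒m<n∨m≡n p≤x) (m≤n⇒m<n∨m≡n (ℕₚ.≤-pred (subst (z <_) (split-end p l r) z<end)))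
    where
    q = suc (p + l + r)
    m′ = suc p + l
    q<n : q < n
    q<n = subst (_≤ n) (split-end p l r) bound
    fs = split-families p l r
    x∈ : x ∈ interval p (2 + (l + r))
    x∈ = ∈-interval p≤x (<-trans x<y (<-trans y<z z<end))
    y∈ : y ∈ interval p (2 + (l + r))
    y∈ = ∈-interval (≤-trans p≤x (ℕₚ.<⇒≤ x<y)) (<-trans y<z z<end)
    z∈ : z ∈ interval p (2 + (l + r))
    z∈ = ∈-interval (≤-trans p≤x (ℕₚ.<⇒≤ (<-trans x<y y<z))) z<end
    Goal : Set
    Goal = (x , y , z) ∈ unblocked (split L R) p
    listed : Covered fs (interval p (2 + (l + r))) (x , y , z) → Goal
    listed c = ∈-++⁺ˡ (covered⇒∈ fs c)

    left-pair : y < m′ → m′ ≤ z → suc p ≤ x → z < q → Goal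
    left-pair y<m m≤z p<x z<q with root L p<x x<y y<m
    ... | _ , h , refl with m≤n⇒m<n∨m≡n p<x | m≤n⇒m<n∨m≡n (ℕₚ.≤-pred y<m) | m≤n⇒m<n∨m≡n x<y
    ...   | inj₂ refl | inj₂ refl | _ = listed (3rd (_ , z∈ , refl))
    ...   | inj₂ refl | inj₁ _ | inj₂ refl = listed (4th (_ , z∈ , refl))
    ...   | inj₂ refl | inj₁ y<hi | inj₁ x+1<y =
      ⊥-elim (no-copy zero (≤-refl ∷ x+1<y ∷ y<hi ∷ m≤z ∷ [ <-trans z<q q<n ])
        (old (inj₂ (inj₁ h)) ≤-refl (<-trans x+1<y y<hi)) e)
    ...   | inj₁ _ | inj₂ refl | inj₂ eq =
      listed (5th (_ , z∈ , cong (λ a → a , p + l , z) (cong ℕ.pred (sym eq))))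
    ...   | inj₁ lo<x | inj₂ refl | inj₁ x+1<y =
      ⊥-elim (no-copy u2 (lo<x ∷ ≤-refl ∷ x+1<y ∷ m≤z ∷ [ <-trans z<q q<n ])
        e (old (inj₂ (inj₁ h)) (<-trans lo<x ≤-refl) x+1<y))
    ...   | inj₁ lo<x | inj₁ y<hi | _ =
      ⊥-elim (no-copy u4 (lo<x ∷ x<y ∷ y<hi ∷ m≤z ∷ [ <-trans z<q q<n ])
        e (old (inj₂ (inj₁ h)) lo<x (<-trans x<y y<hi)))

    right-pair : x < m′ → m′ ≤ y → z < q → Goal
    right-pair x<m m≤y z<q with root R m≤y y<z z<q
    ... | _ , h , refl with m≤n⇒m<n∨m≡n m≤y | m≤n⇒m<n∨m≡n (ℕₚ.≤-pred z<q) | m≤n⇒m<n∨m≡n y<z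
    ...   | inj₂ refl | inj₂ refl | _ = listed (6th (_ , x∈ , refl))
    ...   | inj₂ refl | inj₁ _ | inj₂ refl = listed (7th (_ , x∈ , refl))
    ...   | inj₂ refl | inj₁ z<hi | inj₁ y+1<z =
      ⊥-elim (no-copy u4 (x<m ∷ ≤-refl ∷ y+1<z ∷ z<hi ∷ [ <-trans ≤-refl q<n ])
        (old (inj₂ (inj₂ h)) ≤-refl (<-trans y+1<z z<hi)) e)
    ...   | inj₁ _ | inj₂ refl | inj₂ eq =
      listed (8th (_ , x∈ , cong (λ a → x , a , p + l + r) (cong ℕ.pred (sym eq))))
    ...   | inj₁ lo<y | inj₂ refl | inj₁ y+1<z =
      ⊥-elim (no-copy u1 (x<m ∷ lo<y ∷ ≤-refl ∷ y+1<z ∷ [ <-trans ≤-refl q<n ])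
        e (old (inj₂ (inj₂ h)) (<-trans lo<y ≤-refl) y+1<z))
    ...   | inj₁ lo<y | inj₁ z<hi | _ =
      ⊥-elim (no-copy u3 (x<m ∷ lo<y ∷ y<z ∷ z<hi ∷ [ <-trans ≤-refl q<n ])
        e (old (inj₂ (inj₂ h)) lo<y (<-trans y<z z<hi)))

    inner : suc p ≤ x → z < q → Goal
    inner p<x z<q with ℕₚ.<-≤-connex z m′ | ℕₚ.<-≤-connex x m′ | ℕₚ.<-≤-connex y m′
    ... | inj₁ z<m | _ | _ = ∈-++⁺ʳ (candidates fs (interval p (2 + (l + r)))) (∈-++⁺ˡ
      (unblocked-complete L (suc p) (≤-trans (s≤s (ℕₚ.m≤m+n (p + l) r)) (ℕₚ.<⇒≤ q<n))
        (λ h → old (inj₂ (inj₁ h))) e p<x x<y y<z z<m))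
    ... | inj₂ _   | inj₂ m≤x | _ = ∈-++⁺ʳ (candidates fs (interval p (2 + (l + r)))) (∈-++⁺ʳ (unblocked L (suc p))
      (unblocked-complete R m′ (ℕₚ.<⇒≤ q<n) (λ h → old (inj₂ (inj₂ h))) e m≤x x<y y<z z<q))
    ... | inj₂ m≤z | inj₁ _   | inj₁ y<m = left-pair y<m m≤z p<x z<q
    ... | inj₂ _   | inj₁ x<m | inj₂ m≤y = right-pair x<m m≤y z<q

    outer : p < x ⊎ p ≡ x → z < q ⊎ z ≡ q → Goal
    outer (inj₁ p<x)  (inj₁ z<q)  = inner p<x z<q
    outer (inj₂ refl) (inj₂ refl) = listed (0th (_ , y∈ , refl))
    outer (inj₂ refl) (inj₁ z<q) with m≤n⇒m<n∨m≡n y<z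
    ... | inj₂ refl  = listed (1st (_ , y∈ , refl))
    -- The blocking triple is {p, y + 1, q}: the middle vertex of a node triple is free, and here it
    -- has to fall between y and z.
    ... | inj₁ y+1<z = ⊥-elim (no-copy zero (x<y ∷ ≤-refl ∷ y+1<z ∷ z<q ∷ [ q<n ])
                         e (old (inj₁ (refl , refl)) (<-trans x<y ≤-refl) (<-trans y+1<z z<q)))
    outer (inj₁ p<x) (inj₂ refl) with m≤n⇒m<n∨m≡n x<y
    ... | inj₂ refl  = listed (2nd (_ , x∈ , refl))
    ... | inj₁ x+1<y = ⊥-elim (no-copy u1 (p<x ∷ ≤-refl ∷ x+1<y ∷ y<z ∷ [ q<n ])
                         (old (inj₁ (refl , refl)) (<-trans p<x ≤-refl) (<-trans x+1<y y<z)) e)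

weight : ∀ {s} → Tree s → ℕ
weight leaf                = 0
weight point               = 0
weight (split {l} {r} L R) = (2 + (l + r)) + (weight L + weight R)

length-unblocked : ∀ {s} (t : Tree s) p → length (unblocked t p) ≡ 9 * weight t
length-unblocked leaf  p = refl
length-unblocked point p = refl
length-unblocked (split {l} {r} L R) p = begin
  length (candidates fs is ++ unblocked L (suc p) ++ unblocked R (suc p + l))
    ≡⟨ length-++ (candidates fs is) ⟩
  length (candidates fs is) + length (unblocked L (suc p) ++ unblocked R (suc p + l))
    ≡⟨ cong₂ _+_ (length-candidates fs is) (length-++ (unblocked L (suc p))) ⟩
  9 * length is + (length (unblocked L (suc p)) + length (unblocked R (suc p + l)))
    ≡⟨ cong₂ _+_ (cong (9 *_) (trans (length-map (p +_) (upTo (2 + (l + r)))) (length-upTo (2 + (l + r)))))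
         (cong₂ _+_ (length-unblocked L (suc p)) (length-unblocked R (suc p + l))) ⟩
  9 * (2 + (l + r)) + (9 * weight L + 9 * weight R)
    ≡⟨ cong (9 * (2 + (l + r)) +_) (ℕₚ.*-distribˡ-+ 9 (weight L) (weight R)) ⟨
  9 * (2 + (l + r)) + 9 * (weight L + weight R)
    ≡⟨ ℕₚ.*-distribˡ-+ 9 (2 + (l + r)) (weight L + weight R) ⟨
  9 * (2 + (l + r) + (weight L + weight R)) ∎
  where
  open ≡-Reasoning
  fs = split-families p l r
  is = interval p (2 + (l + r))

log-half : ∀ {s t} → t ≤ ℕ.⌊ 2 + s /2⌋ → suc ⌊log₂ t ⌋ ≤ ⌊log₂ 2 + s ⌋
log-half {s} {t} t≤ = begin
  suc ⌊log₂ t ⌋                   ≤⟨ s≤s (⌊log₂⌋-mono-≤ t≤) ⟩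
  suc ⌊log₂ ℕ.⌊ 2 + s /2⌋ ⌋      ≡⟨ cong suc (⌊log₂⌊n/2⌋⌋≡⌊log₂n⌋∸1 (2 + s)) ⟩
  -- The truncated subtraction is undone because log₂ (2 + s) is at least 1.
  1 + (⌊log₂ 2 + s ⌋ ∸ 1)         ≡⟨ ℕₚ.m+[n∸m]≡n (⌊log₂⌋-mono-≤ {2} {2 + s} (s≤s (s≤s z≤n))) ⟩
  ⌊log₂ 2 + s ⌋                   ∎
  where open ℕₚ.≤-Reasoning

balanced : ∀ s → ∃ λ (t : Tree s) → weight t ≤ s * suc ⌊log₂ s ⌋
balanced = <-rec _ λ where
    0             _   → leaf , z≤n
    1             _   → point , z≤n
    (suc (suc s)) rec →
      -- Two vertices become the endpoints and the other s are halved; s is rewritten as the sum of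
      -- its halves to match the index of `split`.
      subst (λ s → ∃ λ (t : Tree (2 + s)) → weight t ≤ (2 + s) * suc ⌊log₂ 2 + s ⌋) (ℕₚ.⌊n/2⌋+⌈n/2⌉≡n s)
        (join (rec (s≤s (≤-trans (ℕₚ.⌊n/2⌋≤n s) (ℕₚ.n≤1+n s)))) (rec (s≤s (≤-trans (ℕₚ.⌈n/2⌉≤n s) (ℕₚ.n≤1+n s))))
          (subst (λ s′ → ℕ.⌊ s /2⌋ ≤ ℕ.⌊ 2 + s′ /2⌋) (sym (ℕₚ.⌊n/2⌋+⌈n/2⌉≡n s)) (ℕₚ.n≤1+n _))
          (subst (λ s′ → ℕ.⌈ s /2⌉ ≤ ℕ.⌊ 2 + s′ /2⌋) (sym (ℕₚ.⌊n/2⌋+⌈n/2⌉≡n s)) (ℕₚ.⌊n/2⌋-mono (ℕₚ.n≤1+n (suc s)))))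
  where
  join : ∀ {l r} → (∃ λ (t : Tree l) → weight t ≤ l * suc ⌊log₂ l ⌋) → (∃ λ (t : Tree r) → weight t ≤ r * suc ⌊log₂ r ⌋) →
    l ≤ ℕ.⌊ 2 + (l + r) /2⌋ → r ≤ ℕ.⌊ 2 + (l + r) /2⌋ →
    ∃ λ (t : Tree (2 + (l + r))) → weight t ≤ (2 + (l + r)) * suc ⌊log₂ 2 + (l + r) ⌋
  join {l} {r} (L , wL) (R , wR) l≤ r≤ = split L R , (begin
    s + (weight L + weight R)
      ≤⟨ ℕₚ.+-monoʳ-≤ s (ℕₚ.+-mono-≤ (≤-trans wL (ℕₚ.*-monoʳ-≤ l (log-half l≤))) (≤-trans wR (ℕₚ.*-monoʳ-≤ r (log-half r≤)))) ⟩
    s + (l * d + r * d)    ≡⟨ cong (s +_) (ℕₚ.*-distribʳ-+ d l r) ⟨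
    s + (l + r) * d        ≤⟨ ℕₚ.+-monoʳ-≤ s (ℕₚ.*-monoˡ-≤ d (ℕₚ.m≤n+m (l + r) 2)) ⟩
    s + s * d              ≡⟨ ℕₚ.*-suc s d ⟨
    s * suc d              ∎)
    where
    open ℕₚ.≤-Reasoning
    s = 2 + (l + r)
    d = ⌊log₂ s ⌋

upper-S₃ : SatUpper S₃ nlog
upper-S₃ = 18 , 2 , bound
  where
  Interval : ∀ {s} → Tree s → ℕ → ℕ → ℕ → Set
  Interval t a _ c = Node t 0 a c
  avoid : ∀ {s} (t : Tree s) → Avoids (Interval t) (u0 , u1 , u3) (u0 , u2 , u4)
  avoid t zero p inc h h′ =
    ℕₚ.<⇒≢ (inc u3 u4) (proj₂ (node-unique t h h′ ≤-refl (ℕₚ.<⇒≤ (inc u0 u3)) (ℕₚ.<⇒≤ (inc u3 u4))))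
  avoid t (suc zero) p inc h h′ =
    ℕₚ.<⇒≢ (inc u0 u1) (proj₁ (node-unique t h h′ (ℕₚ.<⇒≤ (inc u0 u1)) (ℕₚ.<⇒≤ (inc u1 u4)) ≤-refl))
  avoid t (suc (suc zero)) p inc h h′ =
    ℕₚ.<⇒≢ (inc u0 u1) (proj₁ (node-unique t h′ h (ℕₚ.<⇒≤ (inc u0 u1)) (ℕₚ.<⇒≤ (inc u1 u3)) (ℕₚ.<⇒≤ (inc u3 u4))))
  avoid t (suc (suc (suc zero))) p inc h h′ =
    ℕₚ.<⇒≢ (inc u0 u1) (proj₁ (node-unique t h h′ (ℕₚ.<⇒≤ (inc u0 u1)) (ℕₚ.<⇒≤ (inc u1 u3)) (ℕₚ.<⇒≤ (inc u3 u4))))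
  avoid t (suc (suc (suc (suc zero)))) p inc h h′ =
    ℕₚ.<⇒≢ (inc u0 u1) (proj₁ (node-unique t h′ h (ℕₚ.<⇒≤ (inc u0 u1)) (ℕₚ.<⇒≤ (inc u1 u3)) (ℕₚ.<⇒≤ (inc u3 u4))))
  avoid t (suc (suc (suc (suc (suc ())))))
  bound : ∀ n → 2 ≤ n → ∃ λ H → Saturated {n} H S₃ × size H ≤ 18 * nlog n
  bound n 2≤n with t , w ← balanced n
    with K , hyp⊑K , sat ← saturate S₃ (hyp {P = Interval t} (λ a _ c → node? t 0 a c) n)
      (free-turned _ (u0 , u1 , u3) (u0 , u2 , u4) (Interval t) (λ a b c _ → hyp⁻ (λ a _ c → node? t 0 a c) a b c)
        λ r p inc _ → avoid t r p λ i j {i<j} → inc (toWitness i<j))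
    = K , sat , (begin
    size K                           ≤⟨ size-≤-list K (unblocked t 0) (λ (below a<b b<c c<n e) →
      unblocked-complete K (λ r asc he hf → proj₁ sat (contains-turned K (u0 , u1 , u3) (u0 , u2 , u4) r asc he hf))
        t 0 ≤-refl (λ {a} {b} {c} h a<b b<c → hyp⁺ (λ a _ c → node? t 0 a c) hyp⊑K a<b b<c (proj₂ (node-bounds t h)) h) e z≤n a<b b<c c<n) ⟩
    length (unblocked t 0)           ≡⟨ length-unblocked t 0 ⟩
    -- 18 = 9 · 2: nine families for each split, and 1 + d ≤ d + d because n ≥ 2.
    9 * weight t                     ≤⟨ ℕₚ.*-monoʳ-≤ 9 (≤-trans w (ℕₚ.*-monoʳ-≤ n (ℕₚ.+-monoˡ-≤ d (⌊log₂⌋-mono-≤ 2≤n)))) ⟩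
    9 * (n * (d + d))                ≡⟨ solve 2 (λ n d → con 9 :* (n :* (d :+ d)) := con 18 :* (n :* d)) refl n d ⟩
    18 * (n * d)                     ∎)
    where
    open ℕₚ.≤-Reasoning
    open +-*-Solver
    d = ⌊log₂ n ⌋

-- Lower bounds

distinct-elim : (Q : Fin n → Fin n → Fin n → Set) →
  (∀ {a b c} → Q a b c → Q b a c) → (∀ {a b c} → Q a b c → Q b c a) →
  (∀ {a b c} → Inc a b c → Q a b c) → ∀ {x y z} → x ≢ y → x ≢ z → y ≢ z → Q x y z
distinct-elim Q swap rot base x≢y x≢z y≢z =
  Sum.[ oriented , rot ∘ swap ∘ oriented ] (cyc-total (x≢y ∘ sym) (x≢z ∘ sym) y≢z)
  where
  oriented : ∀ {x y z} → Cyc x y z → Q x y z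
  oriented (inj₁ i)        = base i
  oriented (inj₂ (inj₁ i)) = rot (rot (base i))
  oriented (inj₂ (inj₂ i)) = rot (base i)

edge-distinct : (H : Hyp n) {x y z : Fin n} → HasEdge H x y z → x ≢ y × y ≢ z × x ≢ z
edge-distinct H = edge-elim H (λ x y z → x ≢ y × y ≢ z × x ≢ z)
  (λ (p , q , r) → p ∘ sym , r , q) (λ (p , q , r) → q , r ∘ sym , p ∘ sym)
  (λ (p , q) _ → Finₚ.<⇒≢ p , Finₚ.<⇒≢ q , Finₚ.<⇒≢ (<-trans p q))

-- Conflicts with a missing triple

infix 4 _∈₃_
_∈₃_ : Fin n → Triple n → Set
v ∈₃ (a , b , c) = v ≡ a ⊎ v ≡ b ⊎ v ≡ c

_∈₃?_ : (v : Fin n) (t : Triple n) → Dec (v ∈₃ t)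
v ∈₃? (a , b , c) = (v Fin.≟ a) ⊎-dec (v Fin.≟ b) ⊎-dec (v Fin.≟ c)

∈₃-swap : ∀ {v a b c : Fin n} → v ∈₃ (a , b , c) → v ∈₃ (b , a , c)
∈₃-swap (inj₁ p)        = inj₂ (inj₁ p)
∈₃-swap (inj₂ (inj₁ p)) = inj₁ p
∈₃-swap (inj₂ (inj₂ p)) = inj₂ (inj₂ p)

∈₃-rotate : ∀ {v a b c : Fin n} → v ∈₃ (a , b , c) → v ∈₃ (b , c , a)
∈₃-rotate (inj₁ p)        = inj₂ (inj₂ p)
∈₃-rotate (inj₂ (inj₁ p)) = inj₁ p
∈₃-rotate (inj₂ (inj₂ p)) = inj₂ (inj₁ p)

image : (Fin m → Fin n) → Triple m → Triple n
image φ (a , b , c) = φ a , φ b , φ c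

∈₃-image⁺ : (φ : Fin m → Fin n) {i : Fin m} (t : Triple m) → i ∈₃ t → φ i ∈₃ image φ t
∈₃-image⁺ φ t (inj₁ refl)        = inj₁ refl
∈₃-image⁺ φ t (inj₂ (inj₁ refl)) = inj₂ (inj₁ refl)
∈₃-image⁺ φ t (inj₂ (inj₂ refl)) = inj₂ (inj₂ refl)

∈₃-image⁻ : (φ : Fin m → Fin n) {v : Fin n} (t : Triple m) → v ∈₃ image φ t → ∃ λ i → i ∈₃ t × φ i ≡ v
∈₃-image⁻ φ (a , b , c) (inj₁ refl)        = a , inj₁ refl , refl
∈₃-image⁻ φ (a , b , c) (inj₂ (inj₁ refl)) = b , inj₂ (inj₁ refl) , refl
∈₃-image⁻ φ (a , b , c) (inj₂ (inj₂ refl)) = c , inj₂ (inj₂ refl) , refl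

-- Equality as vertex sets: a copy determines the new triple only up to the order of its vertices.
record Same (s t : Triple n) : Set where
  constructor same
  field
    to   : ∀ {v} → v ∈₃ s → v ∈₃ t
    from : ∀ {v} → v ∈₃ t → v ∈₃ s

addEdge-edge : (H : Hyp n) (t : Triple n) {p q r : Fin n} →
  HasEdge (addEdge H (proj₁ t) (proj₁ (proj₂ t)) (proj₂ (proj₂ t))) p q r → HasEdge H p q r ⊎ Same (p , q , r) t
addEdge-edge H (x , y , z) = edge-elim (addEdge H x y z) (λ p q r → HasEdge H p q r ⊎ Same (p , q , r) (x , y , z))
  (λ { (inj₁ h) → inj₁ (edge-swap H h) ; (inj₂ (same to from)) → inj₂ (same (to ∘ ∈₃-swap) (∈₃-swap ∘ from)) })
  (λ { (inj₁ h) → inj₁ (edge-rotate H h)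
     ; (inj₂ (same to from)) → inj₂ (same (to ∘ ∈₃-rotate ∘ ∈₃-rotate) (∈₃-rotate ∘ from)) })
  new
  where
  new : ∀ {a b c} → Inc a b c → addEdge H x y z a b c ≡ true → HasEdge H a b c ⊎ Same (a , b , c) (x , y , z)
  new {a} {b} {c} i h with H a b c | a Fin.≟ x | b Fin.≟ y | c Fin.≟ z
  ... | true  | _        | _        | _        = inj₁ (inj₁ (i , refl))
  ... | false | yes refl | yes refl | yes refl = inj₂ (same (λ v → v) (λ v → v))

record Conflict (H : Hyp n) (e f : Triple m) (t : Triple n) : Set where
  field
    {φ}  : Fin m → Fin n
    emb  : Embedding φ
    pair : (EdgeAt H φ f × Same (image φ e) t) ⊎ (EdgeAt H φ e × Same (image φ f) t)

module _ (H : Hyp n) (e f : Triple m) (sat : Saturated H (two-edges e f))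
         {e⊈f : True (any? λ d → (d ∈₃? e) ×-dec ¬? (d ∈₃? f))} where

  -- The copy uses the new triple exactly once. It must use it because `H` is free, and cannot use
  -- it twice because the image of a vertex of `e` outside `f` would also be the image of a vertex
  -- of `f`.
  conflict : ∀ {x y z} → Inc x y z → H x y z ≡ false → Conflict H e f (x , y , z)
  conflict {x} {y} {z} i ¬h with φ , inj , cyc , he ∷ hf ∷ [] ← proj₂ sat x y z i ¬h
    with addEdge-edge H (x , y , z) he | addEdge-edge H (x , y , z) hf
  ... | inj₁ he | inj₁ hf = ⊥-elim (proj₁ sat (φ , inj , cyc , he ∷ hf ∷ []))
  ... | inj₁ he | inj₂ sf = record { emb = embedding inj cyc ; pair = inj₂ (he , sf) }
  ... | inj₂ se | inj₁ hf = record { emb = embedding inj cyc ; pair = inj₁ (hf , se) }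
  ... | inj₂ se | inj₂ sf
    with d , d∈e , d∉f ← toWitness e⊈f
    with d′ , d′∈f , eq ← ∈₃-image⁻ φ f (Same.from sf (Same.to se (∈₃-image⁺ φ e d∈e)))
    = contradiction (subst (_∈₃ f) (inj eq) d′∈f) d∉f

  edge-or-conflict : ∀ {x y z} → x ≢ y → x ≢ z → y ≢ z → HasEdge H x y z ⊎ Conflict H e f (x , y , z)
  edge-or-conflict = distinct-elim (λ x y z → HasEdge H x y z ⊎ Conflict H e f (x , y , z))
    (λ { (inj₁ h) → inj₁ (edge-swap H h)
       ; (inj₂ c) → inj₂ (reorder c ∈₃-swap ∈₃-swap) })
    (λ { (inj₁ h) → inj₁ (edge-rotate H h)
       ; (inj₂ c) → inj₂ (reorder c ∈₃-rotate (∈₃-rotate ∘ ∈₃-rotate)) })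
    base
    where
    reorder : ∀ {s t} → Conflict H e f s → (∀ {v} → v ∈₃ s → v ∈₃ t) → (∀ {v} → v ∈₃ t → v ∈₃ s) → Conflict H e f t
    reorder record { emb = emb ; pair = inj₁ (h , same to from) } st ts =
      record { emb = emb ; pair = inj₁ (h , same (st ∘ to) (from ∘ ts)) }
    reorder record { emb = emb ; pair = inj₂ (h , same to from) } st ts =
      record { emb = emb ; pair = inj₂ (h , same (st ∘ to) (from ∘ ts)) }
    base : ∀ {x y z} → Inc x y z → HasEdge H x y z ⊎ Conflict H e f (x , y , z)
    base {x} {y} {z} i with H x y z in eq
    ... | true  = inj₁ (inj₁ (i , refl))
    ... | false = inj₂ (conflict i eq)

-- Vertices and pairs covered by edges

module _ (H : Hyp n) where

  private
    ends : List (Triple n → Fin n)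
    ends = proj₁ ∷ (proj₁ ∘ proj₂) ∷ (proj₂ ∘ proj₂) ∷ []
    sides : List (Triple n → Fin n × Fin n)
    sides = (λ (a , b , c) → a , b) ∷ (λ (a , b , c) → b , a) ∷ (λ (a , b , c) → a , c) ∷
      (λ (a , b , c) → c , a) ∷ (λ (a , b , c) → b , c) ∷ (λ (a , b , c) → c , b) ∷ []

  vertices : List (Fin n)
  vertices = candidates ends (edgeList H)

  length-vertices : length vertices ≡ 3 * size H
  length-vertices = trans (length-candidates ends (edgeList H)) (cong (3 *_) (length-edgeList H))

  shadow : List (Fin n × Fin n)
  shadow = candidates sides (edgeList H)

  length-shadow : length shadow ≡ 6 * size H
  length-shadow = trans (length-candidates sides (edgeList H)) (cong (6 *_) (length-edgeList H))

  edge-vertex : ∀ {x y z} → HasEdge H x y z → x ∈ vertices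
  edge-vertex h = proj₁ (edge-elim H (λ x y z → x ∈ vertices × y ∈ vertices × z ∈ vertices)
    (λ (p , q , r) → q , p , r) (λ (p , q , r) → q , r , p)
    (λ i h → let e = ∈-edgeList⁺ H i h in
      covered⇒∈ ends (0th (_ , e , refl)) , covered⇒∈ ends (1st (_ , e , refl)) , covered⇒∈ ends (2nd (_ , e , refl))) h)

  edge-side : ∀ {x y z} → HasEdge H x y z → (x , y) ∈ shadow
  edge-side h = proj₁ (edge-elim H (λ x y z → Side x y × Side y z × Side z x)
    (λ (p , q , r) → swap p , swap r , swap q) (λ (p , q , r) → q , r , p)
    (λ i h → let e = ∈-edgeList⁺ H i h in
      (covered⇒∈ sides (0th (_ , e , refl)) , covered⇒∈ sides (1st (_ , e , refl))) ,
      (covered⇒∈ sides (4th (_ , e , refl)) , covered⇒∈ sides (5th (_ , e , refl))) ,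
      (covered⇒∈ sides (3rd (_ , e , refl)) , covered⇒∈ sides (2nd (_ , e , refl)))) h .proj₁)
    where
    Side : Fin n → Fin n → Set
    Side x y = (x , y) ∈ shadow × (y , x) ∈ shadow
    swap : ∀ {x y} → Side x y → Side y x
    swap (p , q) = q , p

  edge-sides : ∀ {p q x y z} → HasEdge H x y z → p ∈₃ (x , y , z) → q ∈₃ (x , y , z) → p ≢ q → (p , q) ∈ shadow
  edge-sides h (inj₁ refl)        (inj₁ refl)        p≢q = contradiction refl p≢q
  edge-sides h (inj₁ refl)        (inj₂ (inj₁ refl)) p≢q = edge-side h
  edge-sides h (inj₁ refl)        (inj₂ (inj₂ refl)) p≢q = edge-side (edge-swap H (edge-rotate H (edge-rotate H h)))
  edge-sides h (inj₂ (inj₁ refl)) (inj₁ refl)        p≢q = edge-side (edge-swap H h)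
  edge-sides h (inj₂ (inj₁ refl)) (inj₂ (inj₁ refl)) p≢q = contradiction refl p≢q
  edge-sides h (inj₂ (inj₁ refl)) (inj₂ (inj₂ refl)) p≢q = edge-side (edge-rotate H h)
  edge-sides h (inj₂ (inj₂ refl)) (inj₁ refl)        p≢q = edge-side (edge-rotate H (edge-rotate H h))
  edge-sides h (inj₂ (inj₂ refl)) (inj₂ (inj₁ refl)) p≢q = edge-side (edge-swap H (edge-rotate H h))
  edge-sides h (inj₂ (inj₂ refl)) (inj₂ (inj₂ refl)) p≢q = contradiction refl p≢q

all-∈⇒≤ : {xs : List (Fin n)} → (∀ v → v ∈ xs) → n ≤ length xs
all-∈⇒≤ all∈ = injection-≤ (λ v → v) (λ _ _ eq → eq) all∈

unique-⊆⇒≤ : {A : Set} {xs ys : List A} → Unique xs → (∀ x → x ∈ ys) → length xs ≤ length ys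
unique-⊆⇒≤ {xs = xs} u all∈ = injection-≤ (List.lookup xs) (unique-lookup u) (λ _ → all∈ _)

-- A lower-order error `a` is traded for a factor 2 once `g` is large enough.
absorb : ∀ {g a b} → g ≤ a + b → 2 * a ≤ g → g ≤ 2 * b
absorb {g} {a} {b} g≤a+b 2a≤g = ℕₚ.+-cancelˡ-≤ g _ _ (begin
  g + g               ≤⟨ ℕₚ.+-mono-≤ g≤a+b g≤a+b ⟩
  (a + b) + (a + b)   ≡⟨ solve 2 (λ a b → (a :+ b) :+ (a :+ b) := con 2 :* a :+ con 2 :* b) refl a b ⟩
  2 * a + 2 * b       ≤⟨ ℕₚ.+-monoˡ-≤ (2 * b) 2a≤g ⟩
  g + 2 * b           ∎)
  where
  open ℕₚ.≤-Reasoning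
  open +-*-Solver

-- No two vertices of the edge are neighbours in the pattern. Embeddings preserve this, so a triple
-- with two consecutive vertices is never its image. Both edges of `M₃` have this property.
Gaps : Triple m → Set
Gaps {m} e = ∀ i → i ∈₃ e → ∀ j → j ∈₃ e → i ≢ j → ∃ λ (l : Fin m) → Cyc i l j

gaps? : (e : Triple m) → Dec (Gaps e)
gaps? e = all? λ i → (i ∈₃? e) →-dec all? λ j → (j ∈₃? e) →-dec (¬? (i Fin.≟ j) →-dec any? λ l → cyc? i l j)

-- The weaker property for `M₂`: two vertices may be neighbours, but not three in a row.
LongPaths : Triple m → Set
LongPaths {m} e = ∀ i → i ∈₃ e → ∀ j → j ∈₃ e → i ≢ j → ∀ h → h ∈₃ e → j ≢ h →
  ∃ λ (l : Fin m) → Cyc i l j ⊎ Cyc j l h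

longPaths? : (e : Triple m) → Dec (LongPaths e)
longPaths? e = all? λ i → (i ∈₃? e) →-dec all? λ j → (j ∈₃? e) →-dec (¬? (i Fin.≟ j) →-dec
  all? λ h → (h ∈₃? e) →-dec (¬? (j Fin.≟ h) →-dec any? λ l → cyc? i l j ⊎-dec cyc? j l h))

-- No chord spanned by one edge separates the vertices of the other, which singles out `M₁` among
-- the disjoint pairs.
Apart : (e f : Triple m) → Set
Apart e f = ∀ i → i ∈₃ e → ∀ j → j ∈₃ e → i ≢ j →
  (∀ l → l ∈₃ f → Cyc i l j) ⊎ (∀ l → l ∈₃ f → Cyc j l i)

apart? : (e f : Triple m) → Dec (Apart e f)
apart? e f = all? λ i → (i ∈₃? e) →-dec all? λ j → (j ∈₃? e) →-dec (¬? (i Fin.≟ j) →-dec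
  ((all? λ l → (l ∈₃? f) →-dec cyc? i l j) ⊎-dec (all? λ l → (l ∈₃? f) →-dec cyc? j l i)))

preimage : (φ : Fin m → Fin n) (e : Triple m) {t : Triple n} → Same (image φ e) t →
  ∀ {v} → v ∈₃ t → ∃ λ i → i ∈₃ e × φ i ≡ v
preimage φ e s v∈ = ∈₃-image⁻ φ e (Same.from s v∈)

corners : {t : Triple m} {Q : Fin m → Set} → (∀ i → i ∈₃ t → Q i) → Q (proj₁ t) × Q (proj₁ (proj₂ t)) × Q (proj₂ (proj₂ t))
corners q = q _ (inj₁ refl) , q _ (inj₂ (inj₁ refl)) , q _ (inj₂ (inj₂ refl))

module _ {φ : Fin m → Fin n} (emb : Embedding φ) {e : Triple m} {x y z : Fin n}
         (s : Same (image φ e) (x , y , z)) (x≢y : x ≢ y) where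

  same-gap : Gaps e → ∃ λ v → Cyc x v y
  same-gap gaps with preimage φ e s (inj₁ refl) | preimage φ e s (inj₂ (inj₁ refl))
  ... | i , i∈ , refl | j , j∈ , refl with l , cyc ← gaps i i∈ j j∈ (x≢y ∘ cong φ) =
    φ l , Embedding.cyclic emb cyc

  same-path : LongPaths e → y ≢ z → ∃ λ v → Cyc x v y ⊎ Cyc y v z
  same-path paths y≢z
    with preimage φ e s (inj₁ refl) | preimage φ e s (inj₂ (inj₁ refl)) | preimage φ e s (inj₂ (inj₂ refl))
  ... | i , i∈ , refl | j , j∈ , refl | h , h∈ , refl
    with paths i i∈ j j∈ (x≢y ∘ cong φ) h h∈ (y≢z ∘ cong φ)
  ...   | l , inj₁ cyc = φ l , inj₁ (Embedding.cyclic emb cyc)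
  ...   | l , inj₂ cyc = φ l , inj₂ (Embedding.cyclic emb cyc)

  same-apart : {f : Triple m} → Apart e f →
    (∀ l → l ∈₃ f → Cyc x (φ l) y) ⊎ (∀ l → l ∈₃ f → Cyc x y (φ l))
  same-apart apart with preimage φ e s (inj₁ refl) | preimage φ e s (inj₂ (inj₁ refl))
  ... | i , i∈ , refl | j , j∈ , refl with apart i i∈ j j∈ (x≢y ∘ cong φ)
  ...   | inj₁ cyc = inj₁ λ l l∈ → Embedding.cyclic emb (cyc l l∈)
  ...   | inj₂ cyc = inj₂ λ l l∈ → cyc-rotate (cyc-rotate (Embedding.cyclic emb (cyc l l∈)))

module _ (H : Hyp n) (e f : Triple m) {x y z : Fin n} where

  conflict-gap : {ge : True (gaps? e)} {gf : True (gaps? f)} → x ≢ y → Conflict H e f (x , y , z) → ∃ λ v → Cyc x v y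
  conflict-gap {ge} {gf} x≢y record { emb = emb ; pair = inj₁ (_ , s) } = same-gap emb s x≢y (toWitness ge)
  conflict-gap {ge} {gf} x≢y record { emb = emb ; pair = inj₂ (_ , s) } = same-gap emb s x≢y (toWitness gf)

  conflict-path : {pe : True (longPaths? e)} {pf : True (longPaths? f)} → x ≢ y → y ≢ z → Conflict H e f (x , y , z) →
    ∃ λ v → Cyc x v y ⊎ Cyc y v z
  conflict-path {pe} {pf} x≢y y≢z record { emb = emb ; pair = inj₁ (_ , s) } = same-path emb s x≢y (toWitness pe) y≢z
  conflict-path {pe} {pf} x≢y y≢z record { emb = emb ; pair = inj₂ (_ , s) } = same-path emb s x≢y (toWitness pf) y≢z

  conflict-apart : {ef : True (apart? e f)} {fe : True (apart? f e)} → x ≢ y → Conflict H e f (x , y , z) →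
    ∃ λ a → ∃ λ b → ∃ λ c → HasEdge H a b c ×
      ((Cyc x a y × Cyc x b y × Cyc x c y) ⊎ (Cyc x y a × Cyc x y b × Cyc x y c))
  conflict-apart {ef} {fe} x≢y record { emb = emb ; pair = inj₁ (h , s) } =
    _ , _ , _ , h , Sum.map corners corners (same-apart emb s x≢y (toWitness ef))
  conflict-apart {ef} {fe} x≢y record { emb = emb ; pair = inj₂ (h , s) } =
    _ , _ , _ , h , Sum.map corners corners (same-apart emb s x≢y (toWitness fe))

no-between : {x y v : Fin n} → toℕ y ≡ suc (toℕ x) → ¬ Cyc x v y
no-between eq (inj₁ (x<v , v<y)) = gap x<v v<y eq
no-between eq (inj₂ (inj₁ (_ , y<x))) = ℕₚ.<⇒≱ y<x (subst (_ ≤_) (sym eq) (ℕₚ.n≤1+n _))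
no-between eq (inj₂ (inj₂ (y<x , _))) = ℕₚ.<⇒≱ y<x (subst (_ ≤_) (sym eq) (ℕₚ.n≤1+n _))

consecutive-≢ : {x y : Fin n} → toℕ y ≡ suc (toℕ x) → x ≢ y
consecutive-≢ eq refl = ℕₚ.1+n≢n (sym eq)

-- Every vertex lies on a run of three, and all runs are edges, so the edges cover n vertices with
-- three each.
lower-M₂ : SatLower M₂ lin
lower-M₂ = 2 , 3 , λ { (suc (suc (suc n))) _ H sat →
  subst (_ ≤_) (length-vertices H) (all-∈⇒≤ (covered H sat)) ; 1 (s≤s ()) ; 2 (s≤s (s≤s ())) }
  where
  run : ∀ {n} (H : Hyp n) → Saturated H M₂ → ∀ {x y z} → toℕ y ≡ suc (toℕ x) → toℕ z ≡ suc (toℕ y) → HasEdge H x y z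
  run H sat {x} {y} {z} xy yz
    with edge-or-conflict H (u0 , u1 , u3) (u2 , u4 , u5) sat (consecutive-≢ xy) x≢z (consecutive-≢ yz)
    where
    x≢z : x ≢ z
    x≢z refl = ℕₚ.m≢1+m+n (toℕ x) {1} (trans yz (trans (cong suc xy) (cong suc (sym (ℕₚ.+-comm (toℕ x) 1)))))
  ... | inj₁ h = h
  ... | inj₂ c with conflict-path H (u0 , u1 , u3) (u2 , u4 , u5) (consecutive-≢ xy) (consecutive-≢ yz) c
  ...   | v , inj₁ cyc = contradiction cyc (no-between xy)
  ...   | v , inj₂ cyc = contradiction cyc (no-between yz)
  covered : ∀ {n} (H : Hyp (3 + n)) → Saturated H M₂ → ∀ v → v ∈ vertices H
  covered H sat zero          = edge-vertex H (run H sat {zero} {suc zero} {suc (suc zero)} refl refl)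
  covered H sat (suc zero)    = edge-vertex H (edge-rotate H (run H sat {zero} {suc zero} {suc (suc zero)} refl refl))
  covered H sat (suc (suc v)) = edge-vertex H (edge-rotate H (edge-rotate H
    (run H sat {inject₁ (inject₁ v)} {suc (inject₁ v)} {suc (suc v)}
    (cong suc (sym (Finₚ.toℕ-inject₁ _))) (cong (λ i → suc (suc i)) (sym (Finₚ.toℕ-inject₁ v))))))

-- All but 2n ordered pairs lie in an edge: (x, x) and x with its partner are the exceptions. An
-- edge covers six ordered pairs, and for n ≥ 4 the term 2n costs another factor 2.
pairs-lower : (F : CGH) →
  (∀ {n} (H : Hyp (2 + n)) → Saturated H F → ∀ x → ∃ λ y → ∀ z → z ≢ x → z ≢ y → HasEdge H x z y) → SatLower F quad
pairs-lower F partner = 11 , 4 , λ { (suc (suc n)) 4≤n H sat → bound H (partner H sat) 4≤n ; 1 (s≤s ()) }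
  where
  bound : ∀ {n} (H : Hyp n) → (∀ x → ∃ λ y → ∀ z → z ≢ x → z ≢ y → HasEdge H x z y) → 4 ≤ n → n * n ≤ 12 * size H
  bound {n} H partner 4≤n = subst (n * n ≤_) (trans (cong (2 *_) (length-shadow H)) (sym (ℕₚ.*-assoc 2 6 (size H))))
    (absorb {b = length (shadow H)} all-pairs (begin
      2 * (n + n)   ≡⟨ solve 1 (λ n → con 2 :* (n :+ n) := con 4 :* n) refl n ⟩
      4 * n         ≤⟨ ℕₚ.*-monoˡ-≤ n 4≤n ⟩
      n * n         ∎))
    where
    open ℕₚ.≤-Reasoning
    open +-*-Solver
    diagonal matched : List (Fin n × Fin n)
    diagonal = map (λ x → x , x) (allFin n)
    matched  = map (λ x → x , proj₁ (partner x)) (allFin n)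
    member : ∀ t → t ∈ (diagonal ++ matched) ++ shadow H
    member (x , z) with z Fin.≟ x | z Fin.≟ proj₁ (partner x)
    ... | yes refl | _        = ∈-++⁺ˡ (∈-++⁺ˡ (∈-map⁺ _ (∈-allFin x)))
    ... | no _     | yes refl = ∈-++⁺ˡ (∈-++⁺ʳ diagonal (∈-map⁺ (λ x → x , proj₁ (partner x)) (∈-allFin x)))
    ... | no z≢x   | no z≢y   = ∈-++⁺ʳ (diagonal ++ matched) (edge-side H (proj₂ (partner x) z z≢x z≢y))
    all-pairs : n * n ≤ (n + n) + length (shadow H)
    all-pairs = begin
      n * n
        ≡⟨ cong₂ _*_ (length-tabulate {n = n} _) (length-tabulate {n = n} _) ⟨
      length (allFin n) * length (allFin n)
        ≡⟨ length-cartesianProductWith _,_ (allFin n) (allFin n) ⟨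
      length (cartesianProduct (allFin n) (allFin n))
        ≤⟨ unique-⊆⇒≤ (Unique.cartesianProduct⁺ (Unique.allFin⁺ n) (Unique.allFin⁺ n)) member ⟩
      length ((diagonal ++ matched) ++ shadow H)
        ≡⟨ trans (length-++ (diagonal ++ matched)) (cong (_+ length (shadow H)) (length-++ diagonal)) ⟩
      (length diagonal + length matched) + length (shadow H)
        ≡⟨ cong (_+ length (shadow H)) (cong₂ _+_
             (trans (length-map _ (allFin n)) (length-tabulate {n = n} _))
             (trans (length-map _ (allFin n)) (length-tabulate {n = n} _))) ⟩
      (n + n) + length (shadow H) ∎

lower-M₃ : SatLower M₃ quad
lower-M₃ = pairs-lower M₃ partner
  where
  consecutive : ∀ {n} (H : Hyp n) → Saturated H M₃ → ∀ {x y z} → toℕ y ≡ suc (toℕ x) → z ≢ x → z ≢ y → HasEdge H x y z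
  consecutive H sat xy z≢x z≢y
    with edge-or-conflict H (u0 , u2 , u4) (u1 , u3 , u5) sat (consecutive-≢ xy) (z≢x ∘ sym) (z≢y ∘ sym)
  ... | inj₁ h = h
  ... | inj₂ c = contradiction (proj₂ (conflict-gap H (u0 , u2 , u4) (u1 , u3 , u5) (consecutive-≢ xy) c)) (no-between xy)
  partner : ∀ {n} (H : Hyp (2 + n)) → Saturated H M₃ → ∀ x → ∃ λ y → ∀ z → z ≢ x → z ≢ y → HasEdge H x z y
  partner H sat zero    = suc zero , λ z z≢x z≢y →
    edge-rotate H (edge-swap H (consecutive H sat refl z≢x z≢y))
  partner H sat (suc x) = Fin.inject₁ x , λ z z≢x z≢y →
    edge-rotate H (consecutive H sat (cong suc (sym (Finₚ.toℕ-inject₁ x))) z≢y z≢x)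

-- In a conflict, the image of the shared vertex `i` belongs to the triple and to an edge. This
-- gives n ≤ 2 + 3|H|, hence n ≤ 6|H| for n ≥ 4.
shared-vertex-lower : (i a b c d : Fin m) {e⊈f : True (any? λ j → (j ∈₃? (i , a , b)) ×-dec ¬? (j ∈₃? (i , c , d)))} →
  SatLower (two-edges (i , a , b) (i , c , d)) lin
shared-vertex-lower i a b c d {e⊈f} = 5 , 4 , λ n 4≤n H sat →
  subst (n ≤_) (trans (cong (2 *_) (length-vertices H)) (sym (ℕₚ.*-assoc 2 3 (size H))))
    (absorb {a = 2} {length (vertices H)} (bound H sat) 4≤n)
  where
  one-covered : (H : Hyp n) → Saturated H (two-edges (i , a , b) (i , c , d)) →
    ∀ {x y z} → x ≢ y → x ≢ z → y ≢ z → ∃ λ v → v ∈₃ (x , y , z) × v ∈ vertices H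
  one-covered H sat x≢y x≢z y≢z with edge-or-conflict H (i , a , b) (i , c , d) sat {e⊈f} x≢y x≢z y≢z
  ... | inj₁ h = _ , inj₁ refl , edge-vertex H h
  ... | inj₂ record { pair = inj₁ (h , s) } = _ , Same.to s (inj₁ refl) , edge-vertex H h
  ... | inj₂ record { pair = inj₂ (h , s) } = _ , Same.to s (inj₁ refl) , edge-vertex H h
  bound : (H : Hyp n) → Saturated H (two-edges (i , a , b) (i , c , d)) → n ≤ 2 + length (vertices H)
  bound {n} H sat with any? (λ u → ¬? (Any.any? (u Fin.≟_) (vertices H)))
  ... | no none = ≤-trans
    (all-∈⇒≤ λ v → decidable-stable (Any.any? (v Fin.≟_) (vertices H)) λ v∉ → none (v , v∉)) (ℕₚ.m≤n+m _ 2)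
  ... | yes (u , u∉) with any? (λ w → ¬? (w Fin.≟ u) ×-dec ¬? (Any.any? (w Fin.≟_) (vertices H)))
  ...   | no none = ≤-trans (all-∈⇒≤ listed) (ℕₚ.n≤1+n _)
    where
    listed : ∀ v → v ∈ u ∷ vertices H
    listed v with v Fin.≟ u
    ... | yes v≡u = here v≡u
    ... | no v≢u  = there (decidable-stable (Any.any? (v Fin.≟_) (vertices H)) λ v∉ → none (v , v≢u , v∉))
  ...   | yes (w , w≢u , w∉) = all-∈⇒≤ listed
    where
    listed : ∀ v → v ∈ u ∷ w ∷ vertices H
    listed v with v Fin.≟ u | v Fin.≟ w
    ... | yes v≡u | _       = here v≡u
    ... | no _    | yes v≡w = there (here v≡w)
    ... | no v≢u  | no v≢w with one-covered H sat {u} {w} {v} (w≢u ∘ sym) (v≢u ∘ sym) (v≢w ∘ sym)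
    ...   | _ , inj₁ refl , u∈        = contradiction u∈ u∉
    ...   | _ , inj₂ (inj₁ refl) , w∈ = contradiction w∈ w∉
    ...   | _ , inj₂ (inj₂ refl) , v∈ = there (there v∈)

shared-side-lower : (e f : Triple m) {e⊈f : True (any? λ j → (j ∈₃? e) ×-dec ¬? (j ∈₃? f))} (i j : Fin m) →
  i ≢ j → i ∈₃ e → i ∈₃ f → j ∈₃ e → j ∈₃ f → SatLower (two-edges e f) quad
-- 36 = 2 · 3 · 6: an edge covers six ordered pairs, a pair has three positions in an ordered
-- triple, and the diagonal term 3n is absorbed by a factor 2 for n ≥ 6.
shared-side-lower e f {e⊈f} i j i≢j i∈e i∈f j∈e j∈f = 35 , 6 , λ n 6≤n H sat → bound H sat 6≤n
  where
  -- Equal coordinates count as near, so that all n³ ordered triples can be counted without a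
  -- distinctness condition.
  Near : Hyp n → (x y : Fin n) → Set
  Near H x y = x ≡ y ⊎ (x , y) ∈ shadow H
  choose : (H : Hyp n) {x y z p q : Fin n} → p ∈₃ (x , y , z) → q ∈₃ (x , y , z) → p ≢ q →
    (p , q) ∈ shadow H → (q , p) ∈ shadow H → Near H x y ⊎ Near H y z ⊎ Near H x z
  choose H (inj₁ refl)        (inj₁ refl)        p≢q pq qp = contradiction refl p≢q
  choose H (inj₁ refl)        (inj₂ (inj₁ refl)) p≢q pq qp = inj₁ (inj₂ pq)
  choose H (inj₁ refl)        (inj₂ (inj₂ refl)) p≢q pq qp = inj₂ (inj₂ (inj₂ pq))
  choose H (inj₂ (inj₁ refl)) (inj₁ refl)        p≢q pq qp = inj₁ (inj₂ qp)
  choose H (inj₂ (inj₁ refl)) (inj₂ (inj₁ refl)) p≢q pq qp = contradiction refl p≢q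
  choose H (inj₂ (inj₁ refl)) (inj₂ (inj₂ refl)) p≢q pq qp = inj₂ (inj₁ (inj₂ pq))
  choose H (inj₂ (inj₂ refl)) (inj₁ refl)        p≢q pq qp = inj₂ (inj₂ (inj₂ qp))
  choose H (inj₂ (inj₂ refl)) (inj₂ (inj₁ refl)) p≢q pq qp = inj₂ (inj₁ (inj₂ qp))
  choose H (inj₂ (inj₂ refl)) (inj₂ (inj₂ refl)) p≢q pq qp = contradiction refl p≢q
  some-near : (H : Hyp n) → Saturated H (two-edges e f) → ∀ x y z → Near H x y ⊎ Near H y z ⊎ Near H x z
  some-near H sat x y z with x Fin.≟ y | y Fin.≟ z | x Fin.≟ z
  ... | yes x≡y | _       | _       = inj₁ (inj₁ x≡y)
  ... | no _    | yes y≡z | _       = inj₂ (inj₁ (inj₁ y≡z))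
  ... | no _    | no _    | yes x≡z = inj₂ (inj₂ (inj₁ x≡z))
  ... | no x≢y  | no y≢z  | no x≢z with edge-or-conflict H e f sat {e⊈f} x≢y x≢z y≢z
  ...   | inj₁ h = inj₁ (inj₂ (edge-side H h))
  ...   | inj₂ record { φ = φ ; emb = emb ; pair = inj₁ (h , s) } =
    choose H (Same.to s (∈₃-image⁺ φ e i∈e)) (Same.to s (∈₃-image⁺ φ e j∈e)) (i≢j ∘ emb .Embedding.injective)
      (edge-sides H h (∈₃-image⁺ φ f i∈f) (∈₃-image⁺ φ f j∈f) (i≢j ∘ emb .Embedding.injective))
      (edge-sides H h (∈₃-image⁺ φ f j∈f) (∈₃-image⁺ φ f i∈f) (i≢j ∘ sym ∘ emb .Embedding.injective))
  ...   | inj₂ record { φ = φ ; emb = emb ; pair = inj₂ (h , s) } =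
    choose H (Same.to s (∈₃-image⁺ φ f i∈f)) (Same.to s (∈₃-image⁺ φ f j∈f)) (i≢j ∘ emb .Embedding.injective)
      (edge-sides H h (∈₃-image⁺ φ e i∈e) (∈₃-image⁺ φ e j∈e) (i≢j ∘ emb .Embedding.injective))
      (edge-sides H h (∈₃-image⁺ φ e j∈e) (∈₃-image⁺ φ e i∈e) (i≢j ∘ sym ∘ emb .Embedding.injective))
  -- Every one of the n³ triples (x, y, z) contains a near pair, and a near pair lies in 3n of them.
  bound : (H : Hyp n) → Saturated H (two-edges e f) → 6 ≤ n → n * n ≤ 36 * size H
  bound {n} H sat 6≤n = subst (n * n ≤_) (trans (cong (λ s → 2 * (3 * s)) (length-shadow H))
      (solve 1 (λ s → con 2 :* (con 3 :* (con 6 :* s)) := con 36 :* s) refl (size H)))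
    (absorb {a = 3 * n} {3 * length (shadow H)} square (begin
      2 * (3 * n)   ≡⟨ ℕₚ.*-assoc 2 3 n ⟨
      6 * n         ≤⟨ ℕₚ.*-monoˡ-≤ n 6≤n ⟩
      n * n         ∎))
    where
    open ℕₚ.≤-Reasoning
    open +-*-Solver
    diagonal near : List (Fin n × Fin n)
    diagonal = map (λ x → x , x) (allFin n)
    near = diagonal ++ shadow H
    near⁺ : ∀ {x y} → Near H x y → (x , y) ∈ near
    near⁺ {x} (inj₁ refl) = ∈-++⁺ˡ (∈-map⁺ (λ x → x , x) (∈-allFin x))
    near⁺     (inj₂ xy)   = ∈-++⁺ʳ diagonal xy
    placings : List ((Fin n × Fin n) × Fin n → Triple n)
    placings = (λ ((p , q) , v) → p , q , v) ∷ (λ ((p , q) , v) → v , p , q) ∷ (λ ((p , q) , v) → p , v , q) ∷ []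
    member : ∀ t → t ∈ candidates placings (cartesianProduct near (allFin n))
    member (x , y , z) with some-near H sat x y z
    ... | inj₁ xy        = covered⇒∈ placings (0th (_ , ∈-cartesianProduct⁺ (near⁺ xy) (∈-allFin z) , refl))
    ... | inj₂ (inj₁ yz) = covered⇒∈ placings (1st (_ , ∈-cartesianProduct⁺ (near⁺ yz) (∈-allFin x) , refl))
    ... | inj₂ (inj₂ xz) = covered⇒∈ placings (2nd (_ , ∈-cartesianProduct⁺ (near⁺ xz) (∈-allFin y) , refl))
    length-allFin : length (allFin n) ≡ n
    length-allFin = length-tabulate {n = n} _
    square : n * n ≤ 3 * n + 3 * length (shadow H)
    square = ℕₚ.*-cancelʳ-≤ (n * n) (3 * n + 3 * length (shadow H)) n {{ℕ.>-nonZero (≤-trans z<s 6≤n)}} (begin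
      n * n * n
        ≡⟨ ℕₚ.*-assoc n n n ⟩
      n * (n * n)
        ≡⟨ cong₂ _*_ length-allFin (cong₂ _*_ length-allFin length-allFin) ⟨
      length (allFin n) * (length (allFin n) * length (allFin n))
        ≡⟨ trans (length-cartesianProductWith _,_ (allFin n) (cartesianProduct (allFin n) (allFin n)))
             (cong (length (allFin n) *_) (length-cartesianProductWith _,_ (allFin n) (allFin n))) ⟨
      length (triples n)
        ≤⟨ unique-⊆⇒≤ (Unique.cartesianProduct⁺ (Unique.allFin⁺ n)
             (Unique.cartesianProduct⁺ (Unique.allFin⁺ n) (Unique.allFin⁺ n))) member ⟩
      length (candidates placings (cartesianProduct near (allFin n)))
        ≡⟨ trans (length-candidates placings (cartesianProduct near (allFin n)))
             (cong (3 *_) (length-cartesianProductWith _,_ near (allFin n))) ⟩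
      3 * (length near * length (allFin n))
        ≡⟨ cong (3 *_) (cong₂ _*_ (trans (length-++ diagonal)
             (cong (_+ length (shadow H)) (trans (length-map _ (allFin n)) length-allFin))) length-allFin) ⟩
      3 * ((n + length (shadow H)) * n)
        ≡⟨ solve 2 (λ n s → con 3 :* ((n :+ s) :* n) := (con 3 :* n :+ con 3 :* s) :* n) refl n (length (shadow H)) ⟩
      (3 * n + 3 * length (shadow H)) * n ∎)

lower-S₁ : SatLower S₁ lin
lower-S₁ = shared-vertex-lower u0 u1 u4 u2 u3

lower-S₂ : SatLower S₂ lin
lower-S₂ = shared-vertex-lower u0 u1 u2 u3 u4

lower-S₃ : SatLower S₃ lin
lower-S₃ = shared-vertex-lower u0 u1 u3 u2 u4

lower-D₁ : SatLower D₁ quad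
lower-D₁ = shared-side-lower (u0 , u1 , u2) (u0 , u2 , u3) u0 u2 (λ ()) (inj₁ refl) (inj₁ refl) (inj₂ (inj₂ refl)) (inj₂ (inj₁ refl))

lower-D₂ : SatLower D₂ quad
lower-D₂ = shared-side-lower (u0 , u1 , u2) (u0 , u1 , u3) u0 u1 (λ ()) (inj₁ refl) (inj₁ refl) (inj₂ (inj₁ refl)) (inj₂ (inj₁ refl))

-- The lower bound for M₁

cyc-≢ : {x y z : Fin n} → Cyc x y z → y ≢ x × z ≢ x
cyc-≢ c = (λ { refl → cyc-irrefl (cyc-rotate (cyc-rotate c)) }) , (λ { refl → cyc-irrefl (cyc-rotate c) })

module _ (H : Hyp n) (x : Fin n) where

  -- `Cyc x` relates only vertices other than `x`, so the edge avoids `x`, and `c` is its last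
  -- vertex clockwise from `x`.
  Top : Fin n → Set
  Top c = ∃ λ a → ∃ λ b → Cyc x a b × Cyc x b c × HasEdge H a b c

  top? : ∀ c → Dec (Top c)
  top? c = any? λ a → any? λ b → cyc? x a b ×-dec cyc? x b c ×-dec hasEdge? H a b c

  arrange : {Q : Fin n → Set} → (∀ {v} → Q v → v ≢ x) → ∀ {a b c} → HasEdge H a b c → Q a × Q b × Q c →
    ∃ λ a → ∃ λ b → ∃ λ c → (Cyc x a b × Cyc x b c × HasEdge H a b c) × Q a × Q b × Q c
  arrange away h (qa , qb , qc) with a≢b , b≢c , a≢c ← edge-distinct H h
    with cyc-total (away qa) (away qb) a≢b | cyc-total (away qb) (away qc) b≢c | cyc-total (away qa) (away qc) a≢c
  ... | inj₁ ab | inj₁ bc | _       = _ , _ , _ , (ab , bc , h) , qa , qb , qc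
  ... | inj₁ ab | inj₂ cb | inj₁ ac = _ , _ , _ , (ac , cb , edge-swap H (edge-rotate H (edge-rotate H h))) , qa , qc , qb
  ... | inj₁ ab | inj₂ cb | inj₂ ca = _ , _ , _ , (ca , ab , edge-rotate H (edge-rotate H h)) , qc , qa , qb
  ... | inj₂ ba | inj₁ bc | inj₁ ac = _ , _ , _ , (ba , ac , edge-swap H h) , qb , qa , qc
  ... | inj₂ ba | inj₁ bc | inj₂ ca = _ , _ , _ , (bc , ca , edge-rotate H h) , qb , qc , qa
  ... | inj₂ ba | inj₂ cb | _       = _ , _ , _ , (cb , ba , edge-swap H (edge-rotate H h)) , qc , qb , qa

  lowest-top : ∃ Top → ∃ λ y → Top y × (∀ {z} → Top z → ¬ Cyc x z y)
  lowest-top (y , top) = search top (spo-wellFounded order y)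
    where
    order : IsStrictPartialOrder _≡_ (Cyc x)
    order = record
      { isEquivalence = isEquivalence
      ; irrefl = λ { refl → cyc-irrefl }
      ; trans = cyc-trans
      ; <-resp-≈ = (λ { refl c → c }) , (λ { refl c → c }) }
    search : ∀ {y} → Top y → Acc (Cyc x) y → ∃ λ y → Top y × (∀ {z} → Top z → ¬ Cyc x z y)
    search {y} top (acc smaller) with any? (λ z → top? z ×-dec cyc? x z y)
    ... | yes (z , top′ , z<y) = search top′ (smaller z<y)
    ... | no none              = y , top , λ top′ z<y → none (_ , top′ , z<y)

chain-embedding : (x : Fin n) {v : Vec (Fin n) m} → Linked (Cyc x) v → Embedding (lookup v)
chain-embedding x {v} linked = embedding lookup-injective λ i j l i<j j<l → cyc-transʳ (ahead i<j) (ahead j<l)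
  where
  ahead : ∀ {i j} → i Fin.< j → Cyc x (lookup v i) (lookup v j)
  ahead = Linked.lookup⁺ cyc-trans linked
  lookup-injective : ∀ {i j} → lookup v i ≡ lookup v j → i ≡ j
  lookup-injective {i} {j} eq with Finₚ.<-cmp i j
  ... | tri< i<j _ _ = ⊥-elim (cyc-irrefl (subst (Cyc x _) (sym eq) (ahead i<j)))
  ... | tri≈ _ i≡j _ = i≡j
  ... | tri> _ _ j<i = ⊥-elim (cyc-irrefl (subst (Cyc x _) eq (ahead j<i)))

-- Read clockwise from x, let y be the first vertex at which an edge avoiding x ends.  Neither of the
-- two arcs between x and y contains an edge, so no edge is separated from {x, y, z}.
lower-M₁ : SatLower M₁ quad
lower-M₁ = pairs-lower M₁ partner
  where
  other : ∀ {n} (x : Fin (2 + n)) → ∃ λ y → y ≢ x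
  other zero    = suc zero , λ ()
  other (suc x) = zero , λ ()
  partner : ∀ {n} (H : Hyp (2 + n)) → Saturated H M₁ → ∀ x → ∃ λ y → ∀ z → z ≢ x → z ≢ y → HasEdge H x z y
  partner H sat x with any? (top? H x)
  -- Here every edge contains `x`, whereas a conflict would yield an edge inside an open arc between
  -- `x` and `y`; so any `y` serves.
  ... | no none with y , y≢x ← other x = y , edge
    where
    edge : ∀ z → z ≢ x → z ≢ y → HasEdge H x z y
    edge z z≢x z≢y with edge-or-conflict H (u0 , u1 , u2) (u3 , u4 , u5) sat {x = x} {y} {z}
      (y≢x ∘ sym) (z≢x ∘ sym) (z≢y ∘ sym)
    ... | inj₁ h = edge-rotate H (edge-swap H h)
    ... | inj₂ c with conflict-apart H (u0 , u1 , u2) (u3 , u4 , u5) (y≢x ∘ sym) c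
    ...   | _ , _ , _ , h , inj₁ arc with _ , _ , _ , top , _ ← arrange H x (λ p → proj₁ (cyc-≢ p)) h arc =
      contradiction (_ , _ , _ , top) none
    ...   | _ , _ , _ , h , inj₂ arc with _ , _ , _ , top , _ ← arrange H x (λ p → proj₂ (cyc-≢ p)) h arc =
      contradiction (_ , _ , _ , top) none
  partner H sat x | yes tops with y , (a , b , ab , by , hy) , lowest ← lowest-top H x tops = y , edge
    where
    y≢x : y ≢ x
    y≢x = proj₂ (cyc-≢ by)
    edge : ∀ z → z ≢ x → z ≢ y → HasEdge H x z y
    edge z z≢x z≢y with edge-or-conflict H (u0 , u1 , u2) (u3 , u4 , u5) sat {x = x} {y} {z}
      (y≢x ∘ sym) (z≢x ∘ sym) (z≢y ∘ sym)
    ... | inj₁ h = edge-rotate H (edge-swap H h)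
    ... | inj₂ c with conflict-apart H (u0 , u1 , u2) (u3 , u4 , u5) (y≢x ∘ sym) c
    ...   | _ , _ , _ , h , inj₁ arc
      with _ , _ , _ , top , _ , _ , c<y ← arrange H x (λ p → proj₁ (cyc-≢ p)) h arc =
      -- An edge on the arc from `x` to `y` would end before `y`, the first such end.
      contradiction c<y (lowest (_ , _ , top))
    ...   | _ , _ , _ , h , inj₂ arc
      with _ , _ , _ , (ab′ , bc′ , h′) , y<a , _ ← arrange H x (λ p → proj₂ (cyc-≢ p)) h arc
      -- An edge beyond `y` and the edge ending at `y` occupy disjoint arcs, which is a copy of `M₁`
      -- in `H`.
      with emb ← chain-embedding x (ab ∷ by ∷ y<a ∷ ab′ ∷ bc′ ∷ [-]) =
      ⊥-elim (proj₁ sat (_ , emb .Embedding.injective , (λ i j l i<j j<l → emb .Embedding.cyclic (inj₁ (i<j , j<l))) , hy ∷ h′ ∷ []))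

theorem1p2 : (SatTheta M₂ lin × SatTheta S₁ lin × SatTheta S₂ lin)
    × (SatTheta M₁ quad × SatTheta M₃ quad × SatTheta D₁ quad × SatTheta D₂ quad)
    × (SatLower S₃ lin × SatUpper S₃ nlog)
theorem1p2 =
  ((lower-M₂ , upper-M₂) , (lower-S₁ , upper-S₁) , (lower-S₂ , upper-S₂)) ,
  ((lower-M₁ , upper-M₁) , (lower-M₃ , upper-M₃) , (lower-D₁ , upper-D₁) , (lower-D₂ , upper-D₂)) ,
  (lower-S₃ , upper-S₃)
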